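{- Let $\mathbf d=(d_1,\ldots,d_n)$ be a graphical degree sequence and let $H_1$ and $H_2$ be two edge-disjoint graphs on $[n]$. Suppose that $\mathbf d^{H_1}\preceq \mathbf d$ and that $uv\notin H_1\cup H_2$. Then \[ \mathbb P\big(uv\in \mathcal G(n,\mathbf d)\mid H_1^+, H_2^-\big)\le \frac{(d_u-d^{H_1}_u)(d_v-d^{H_1}_v)}{M-2e(H_1)}\cdot f(\mathbf d,H_1,H_2), \] \[ \mathbb P\big(uv\in \mathcal G(n,\mathbf d)\mid H_1^+, H_2^-\big)\ge \frac{(d_u-d^{H_1}_u)(d_v-d^{H_1}_v)}{M-2e(H_1)}\cdot g(\mathbf d,H_1,H_2), \] where \[ f(\mathbf d,H_1,H_2)=\left(1-\frac{3J(\mathbf d)+\Delta(8+d_u^{H_2}+d_v^{H_2})}{M-2e(H_1)}-\frac{2e(H_2)\Delta^2}{(M-2e(H_1))^2}+\frac{(d_v-d_v^{H_1})(d_u-d_u^{H_1})}{M-2e(H_1)}\right)^{ -1}, \] \[ g(\mathbf d,H_1,H_2)=\left(1- \frac{2J(\mathbf d)+6\Delta+2\Delta(H_2)\Delta}{M-2e(H_1)} \right)\left(1+ \frac{(d_v-d_v^{H_1})(d_u-d_u^{H_1})}{M-2e(H_1)} \right)^{ -1}. \]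
   Context: For a sequence $\mathbf d=(d_1,\ldots,d_n)$ of nonnegative integers, $\mathcal G(n,\mathbf d)$ denotes a uniformly random simple graph on vertex set $[n]$ in which vertex $i$ has degree $d_i$ for every $i$; $\mathbf d$ is graphical if at least one such graph exists. $\Delta=\max_i d_i$, $M=\sum_{i=1}^n d_i$, and $J(\mathbf d)$ is the sum of the $\Delta$ largest entries of $\mathbf d$ (i.e. if $d_1\ge d_2\ge\cdots\ge d_n$, then $J(\mathbf d)=\sum_{i=1}^{\Delta}d_i$). For a graph $H$ on $[n]$, $e(H)$ is its number of edges, $\Delta(H)$ its maximum degree, and $d^H_i$ the degree of vertex $i$ in $H$; $\mathbf d^H=(d^H_1,\dots,d^H_n)$, and $\mathbf d^H\preceq\mathbf d$ means $d^H_i\le d_i$ for all $i$. Graphs on $[n]$ are identified with their edge sets; two such graphs are disjoint if their edge sets are disjoint. $H^+$ denotes the event $H\subseteq\mathcal G(n,\mathbf d)$, and $H^-$ denotes the event that $\mathcal G(n,\mathbf d)$ contains no edge of $H$.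
   Formalization: The upper bound is stated only when the bracket whose inverse is f is positive; otherwise it fails (d=(1,1), H₁, H₂ empty gives 1 ≤ −1/8) or f is undefined. M ≠ 2e(H₁) and P(H₁⁺, H₂⁻) ≠ 0 are made explicit. -}

module Defs where

open import Data.Bool using (Bool; true; false)
open import Data.Fin using (Fin; zero; suc)
open import Data.Fin.Properties using (all?)
open import Data.Fin.Subset using (Subset; inside; outside; ∣_∣; _∈_; _⊆_)
open import Data.Fin.Subset.Properties using (_∈?_; _⊆?_)
open import Data.Integer using (+_)
import Data.Integer as ℤ
import Data.Integer.Properties as ℤ
open import Data.List using (List; []; _∷_; cartesianProductWith; filter; length; take)
open import Data.List.Membership.Propositional using () renaming (_∈_ to _∈ᴸ_)
open import Data.List.Membership.Propositional.Properties
  using (∈-cartesianProductWith⁺; ∈-filter⁺; ∈-length)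
import Data.List.Relation.Unary.All as All
import Data.List.Relation.Unary.AllPairs as AllPairs
open import Data.List.Relation.Unary.Any using (here; there)
open import Data.List.Relation.Unary.Unique.Propositional using (Unique)
import Data.List.Relation.Unary.Unique.Propositional.Properties as Unique
import Data.List.Sort
open import Data.Nat using (ℕ; zero; suc)
import Data.Nat as ℕ
import Data.Nat.Properties as ℕ
open import Data.Nat.Coprimality using (1-coprimeTo)
import Data.Nat.Coprimality as Coprimality
open import Data.Nat.ListAction using (sum)
open import Data.Nat.Tactic.RingSolver using (solve-∀)
open import Data.Product using (∃; _×_; _,_; proj₁; proj₂)
open import Data.Rational
  using (ℚ; mkℚ; *≤*; 1ℚ; _+_; _-_; -_; _*_; _÷_; _/_; 1/_; _≤_;
         NonZero; NonNegative; Positive; nonNegative)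
open import Data.Rational.Properties
  using (↥p/↧p≡p; +-inverseʳ; +-monoˡ-≤; pos⇒nonZero; pos+nonNeg⇒pos;
         nonNeg*nonNeg⇒nonNeg)
open import Data.Vec using (Vec; []; _∷_; lookup; tabulate; toList)
import Data.Vec as Vec
import Data.Vec.Properties as Vec
open import Function using (_∘_)
open import Level using (0ℓ)
open import Relation.Binary.PropositionalEquality
  using (_≡_; refl; sym; trans; cong; cong₂; subst; subst₂)
open import Relation.Binary.Properties.DecTotalOrder ℕ.≤-decTotalOrder
  using (≥-decTotalOrder)
open import Relation.Nullary using (¬_; ¬?)
open import Relation.Unary using (Pred; Decidable)
open import Relation.Unary.Properties using (_∩?_)

------------------------------------------------------------------------
-- Simple graphs on Fin n

-- s ▹ G adds to G a new vertex, which becomes vertex zero, with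
-- neighbourhood s among the old vertices. Each simple graph has exactly
-- one such code (fromNeighbours and neighbours-injective below), so _≡_
-- on Graph n is equality of edge sets.

infixr 5 _▹_

data Graph : ℕ → Set where
  ∅   : Graph 0
  _▹_ : ∀ {n} → Subset n → Graph n → Graph (suc n)

neighbours : ∀ {n} → Graph n → Fin n → Subset n
neighbours (s ▹ G) zero    = outside ∷ s
neighbours (s ▹ G) (suc i) = lookup s i ∷ neighbours G i

Adj : ∀ {n} → Graph n → Fin n → Fin n → Set
Adj G i j = j ∈ neighbours G i

Adj? : ∀ {n} (i j : Fin n) → Decidable (λ (G : Graph n) → Adj G i j)
Adj? i j G = j ∈? neighbours G i

adj-sym : ∀ {n} (G : Graph n) i j →
          lookup (neighbours G i) j ≡ lookup (neighbours G j) i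
adj-sym (s ▹ G) zero    zero    = refl
adj-sym (s ▹ G) zero    (suc j) = refl
adj-sym (s ▹ G) (suc i) zero    = refl
adj-sym (s ▹ G) (suc i) (suc j) = adj-sym G i j

adj-irrefl : ∀ {n} (G : Graph n) i → lookup (neighbours G i) i ≡ false
adj-irrefl (s ▹ G) zero    = refl
adj-irrefl (s ▹ G) (suc i) = adj-irrefl G i

fromNeighbours : ∀ {n} (a : Fin n → Fin n → Bool) →
                 (∀ i j → a i j ≡ a j i) → (∀ i → a i i ≡ false) →
                 ∃ λ (G : Graph n) → ∀ i j → lookup (neighbours G i) j ≡ a i j
fromNeighbours {zero}  a a-sym a-irrefl = ∅ , λ ()
fromNeighbours {suc n} a a-sym a-irrefl = s ▹ proj₁ rec , eq
  where
  s = tabulate (a zero ∘ suc)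
  rec = fromNeighbours (λ i j → a (suc i) (suc j))
          (λ i j → a-sym (suc i) (suc j)) (a-irrefl ∘ suc)
  eq : ∀ i j → lookup (neighbours (s ▹ proj₁ rec) i) j ≡ a i j
  eq zero    zero    = sym (a-irrefl zero)
  eq zero    (suc j) = Vec.lookup∘tabulate (a zero ∘ suc) j
  eq (suc i) zero    = trans (Vec.lookup∘tabulate (a zero ∘ suc) i) (a-sym zero (suc i))
  eq (suc i) (suc j) = proj₂ rec i j

neighbours-injective : ∀ {n} (G H : Graph n) →
                       (∀ i → neighbours G i ≡ neighbours H i) → G ≡ H
neighbours-injective ∅       ∅       eq = refl
neighbours-injective (s ▹ G) (t ▹ H) eq =
  cong₂ _▹_ (cong Vec.tail (eq zero))
            (neighbours-injective G H (cong Vec.tail ∘ eq ∘ suc))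

deg : ∀ {n} → Graph n → Fin n → ℕ
deg G i = ∣ neighbours G i ∣

degrees : ∀ {n} → Graph n → Vec ℕ n
degrees G = tabulate (deg G)

edges : ∀ {n} → Graph n → ℕ
edges ∅       = 0
edges (s ▹ G) = ∣ s ∣ ℕ.+ edges G

_⊆ᴳ_ : ∀ {n} → Graph n → Graph n → Set
H ⊆ᴳ G = ∀ i → neighbours H i ⊆ neighbours G i

EdgeDisjoint : ∀ {n} → Graph n → Graph n → Set
EdgeDisjoint H G = ∀ i j → ¬ (Adj H i j × Adj G i j)

------------------------------------------------------------------------
-- Degree sequences

infix 4 _≼_

_≼_ : ∀ {n} → Vec ℕ n → Vec ℕ n → Set
c ≼ d = ∀ i → lookup c i ℕ.≤ lookup d i

Graphical : ∀ {n} → Vec ℕ n → Set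
Graphical {n} d = ∃ λ (G : Graph n) → degrees G ≡ d

maximum : ∀ {n} → Vec ℕ n → ℕ
maximum = Vec.foldr _ ℕ._⊔_ 0

sortDescending : List ℕ → List ℕ
sortDescending = Data.List.Sort.sort ≥-decTotalOrder

J : ∀ {n} → Vec ℕ n → ℕ
J d = sum (take (maximum d) (sortDescending (toList d)))

------------------------------------------------------------------------
-- The uniform random graph 𝒢(n, d)

subsets : ∀ n → List (Subset n)
subsets zero    = [] ∷ []
subsets (suc n) = cartesianProductWith _∷_ (outside ∷ inside ∷ []) (subsets n)

graphs : ∀ n → List (Graph n)
graphs zero    = ∅ ∷ []
graphs (suc n) = cartesianProductWith _▹_ (subsets n) (graphs n)

∈-subsets : ∀ {n} (s : Subset n) → s ∈ᴸ subsets n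
∈-subsets []            = here refl
∈-subsets (outside ∷ s) = ∈-cartesianProductWith⁺ _∷_ {xs = outside ∷ inside ∷ []} (here refl) (∈-subsets s)
∈-subsets (inside ∷ s)  = ∈-cartesianProductWith⁺ _∷_ {xs = outside ∷ inside ∷ []} (there (here refl)) (∈-subsets s)

∈-graphs : ∀ {n} (G : Graph n) → G ∈ᴸ graphs n
∈-graphs ∅       = here refl
∈-graphs (s ▹ G) = ∈-cartesianProductWith⁺ _▹_ (∈-subsets s) (∈-graphs G)

subsets-unique : ∀ n → Unique (subsets n)
subsets-unique zero    = All.[] AllPairs.∷ AllPairs.[]
subsets-unique (suc n) =
  Unique.cartesianProductWith⁺ _∷_ (λ { refl → refl , refl })
    (((λ ()) All.∷ All.[]) AllPairs.∷ All.[] AllPairs.∷ AllPairs.[])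
    (subsets-unique n)

graphs-unique : ∀ n → Unique (graphs n)
graphs-unique zero    = All.[] AllPairs.∷ AllPairs.[]
graphs-unique (suc n) =
  Unique.cartesianProductWith⁺ _▹_ (λ { refl → refl , refl })
    (subsets-unique n) (graphs-unique n)

realises? : ∀ {n} (d : Vec ℕ n) → Decidable (λ (G : Graph n) → degrees G ≡ d)
realises? d G = Vec.≡-dec ℕ._≟_ (degrees G) d

𝒢 : ∀ {n} → Vec ℕ n → List (Graph n)
𝒢 {n} d = filter (realises? d) (graphs n)

𝒢-nonEmpty : ∀ {n} {d : Vec ℕ n} → Graphical d → ℕ.NonZero (length (𝒢 d))
𝒢-nonEmpty {d = d} (G , G-d) =
  ℕ.>-nonZero (∈-length (∈-filter⁺ (realises? d) (∈-graphs G) G-d))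

-- By ∈-graphs and graphs-unique, 𝒢 d lists each graph with degree
-- sequence d exactly once, so normalised counting is uniform measure.

ℙ : ∀ {n} {d : Vec ℕ n} → Graphical d →
    {A : Pred (Graph n) 0ℓ} → Decidable A → ℚ
ℙ {d = d} graphical A? =
  ((+ length (filter A? (𝒢 d))) / length (𝒢 d)) {{𝒢-nonEmpty graphical}}

condℙ : ∀ {n} {d : Vec ℕ n} (graphical : Graphical d)
        {A B : Pred (Graph n) 0ℓ} (A? : Decidable A) (B? : Decidable B) →
        .{{_ : NonZero (ℙ graphical B?)}} → ℚ
condℙ graphical A? B? = ℙ graphical (A? ∩? B?) ÷ ℙ graphical B?

-- The events H⁺ (contains?) and H⁻ (avoids?).

contains? : ∀ {n} (H : Graph n) → Decidable (λ G → H ⊆ᴳ G)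
contains? H G = all? λ i → neighbours H i ⊆? neighbours G i

avoids? : ∀ {n} (H : Graph n) → Decidable (λ G → EdgeDisjoint H G)
avoids? H G = all? λ i → all? λ j → ¬? ((Adj? i j ∩? λ _ → Adj? i j G) H)

------------------------------------------------------------------------
-- The handshake lemma

private
  ∣∷∣ : ∀ {n} b (s : Subset n) → ∣ b ∷ s ∣ ≡ ∣ b ∷ [] ∣ ℕ.+ ∣ s ∣
  ∣∷∣ false s = refl
  ∣∷∣ true  s = refl

  interchange : ∀ a b c e → (a ℕ.+ b) ℕ.+ (c ℕ.+ e) ≡ (a ℕ.+ c) ℕ.+ (b ℕ.+ e)
  interchange = solve-∀

  double : ∀ a b → a ℕ.+ (a ℕ.+ 2 ℕ.* b) ≡ 2 ℕ.* (a ℕ.+ b)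
  double = solve-∀

  sum-bits : ∀ {m n} (s : Subset m) (f : Fin m → Subset n) →
             Vec.sum (tabulate λ i → ∣ lookup s i ∷ f i ∣) ≡
             ∣ s ∣ ℕ.+ Vec.sum (tabulate λ i → ∣ f i ∣)
  sum-bits []      f = refl
  sum-bits (b ∷ s) f
    rewrite ∣∷∣ b (f zero) | ∣∷∣ b s | sum-bits s (f ∘ suc) =
      interchange (∣ b ∷ [] ∣) (∣ f zero ∣) (∣ s ∣) (Vec.sum (tabulate λ i → ∣ f (suc i) ∣))

handshake : ∀ {n} (G : Graph n) → Vec.sum (degrees G) ≡ 2 ℕ.* edges G
handshake ∅       = refl
handshake (s ▹ G) rewrite sum-bits s (neighbours G) | handshake G =
  double (∣ s ∣) (edges G)

sum-mono-≼ : ∀ {n} (c d : Vec ℕ n) → c ≼ d → Vec.sum c ℕ.≤ Vec.sum d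
sum-mono-≼ []      []      c≼d = ℕ.z≤n
sum-mono-≼ (x ∷ c) (y ∷ d) c≼d =
  ℕ.+-mono-≤ (c≼d zero) (sum-mono-≼ c d (c≼d ∘ suc))

------------------------------------------------------------------------
-- The bounds

ι : ℕ → ℚ
ι n = + n / 1

ι-mono-≤ : ∀ {m n} → m ℕ.≤ n → ι m ≤ ι n
ι-mono-≤ {m} {n} m≤n = subst₂ _≤_ (sym (ι≡ m)) (sym (ι≡ n))
  (*≤* (ℤ.*-monoʳ-≤-nonNeg (+ 1) (ℤ.+≤+ m≤n)))
  where
  ι≡ : ∀ k → ι k ≡ mkℚ (+ k) 0 (Coprimality.sym (1-coprimeTo k))
  ι≡ k = ↥p/↧p≡p (mkℚ (+ k) 0 (Coprimality.sym (1-coprimeTo k)))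

ι-∸-nonNeg : ∀ {m n} → m ℕ.≤ n → NonNegative (ι n - ι m)
ι-∸-nonNeg {m} {n} m≤n = nonNegative
  (subst (_≤ ι n - ι m) (+-inverseʳ (ι m)) (+-monoˡ-≤ (- ι m) (ι-mono-≤ m≤n)))

1/-nonNeg : ∀ p .{{_ : NonZero p}} → NonNegative p → NonNegative (1/ p)
1/-nonNeg (mkℚ (+ suc _) _ _) _ = _

-- M - 2e(H) and dᵢ - dᵢᴴ

residualTotal : ∀ {n} → Vec ℕ n → Graph n → ℚ
residualTotal d H = ι (Vec.sum d) - ι (2 ℕ.* edges H)

residualDegree : ∀ {n} → Vec ℕ n → Graph n → Fin n → ℚ
residualDegree d H i = ι (lookup d i) - ι (deg H i)

module _ {n} (d : Vec ℕ n) (H₁ H₂ : Graph n) (u v : Fin n)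
         .{{_ : NonZero (residualTotal d H₁)}} where

  private
    M′ Δ rᵤ rᵥ : ℚ
    M′ = residualTotal d H₁
    Δ  = ι (maximum d)
    rᵤ = residualDegree d H₁ u
    rᵥ = residualDegree d H₁ v

  ratio : ℚ
  ratio = (rᵤ * rᵥ) ÷ M′

  fDenominator : ℚ
  fDenominator =
    1ℚ - (ι 3 * ι (J d) + Δ * (ι 8 + ι (deg H₂ u) + ι (deg H₂ v))) ÷ M′
       - (ι 2 * ι (edges H₂) * (Δ * Δ)) ÷ M′ ÷ M′
       + ratio

  -- Positivity, not just invertibility, is needed: a negative f would
  -- make the upper bound on a probability negative.
  f : .{{_ : Positive fDenominator}} → ℚ
  f = (1/ fDenominator) {{pos⇒nonZero fDenominator}}

  1+ratio-positive : degrees H₁ ≼ d → Positive (1ℚ + ratio)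
  1+ratio-positive H₁≼d = pos+nonNeg⇒pos 1ℚ ratio {{ratio-nonNeg}}
    where
    residualDegree-nonNeg : ∀ i → NonNegative (residualDegree d H₁ i)
    residualDegree-nonNeg i =
      ι-∸-nonNeg (subst (ℕ._≤ lookup d i) (Vec.lookup∘tabulate (deg H₁) i) (H₁≼d i))

    M′-nonNeg : NonNegative M′
    M′-nonNeg =
      ι-∸-nonNeg (subst (ℕ._≤ Vec.sum d) (handshake H₁) (sum-mono-≼ (degrees H₁) d H₁≼d))

    ratio-nonNeg : NonNegative ratio
    ratio-nonNeg = nonNeg*nonNeg⇒nonNeg (rᵤ * rᵥ)
      {{nonNeg*nonNeg⇒nonNeg rᵤ {{residualDegree-nonNeg u}} rᵥ {{residualDegree-nonNeg v}}}}
      (1/ M′) {{1/-nonNeg M′ M′-nonNeg}}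

  g : degrees H₁ ≼ d → ℚ
  g H₁≼d =
    (1ℚ - (ι 2 * ι (J d) + ι 6 * Δ + ι 2 * ι (maximum (degrees H₂)) * Δ) ÷ M′)
    * (1/ (1ℚ + ratio)) {{pos⇒nonZero (1ℚ + ratio) {{1+ratio-positive H₁≼d}}}}

-- Switchings. Among the graphs with degree sequence d that contain H₁ and
-- avoid H₂, let A and C count those with and without the edge uv; then
-- P = A / (A + C), and both bounds are estimates of A / C. Put
-- m = M - 2e(H₁) and rᵢ = dᵢ - dᵢ^H₁.
--   Upper bound: in a graph with uv, replace uv, xy by ux, vy. Of the m
-- oriented edges xy outside H₁, all but 2J + 2Δ + (d_u^H₂ + d_v^H₂)Δ are
-- suitable, and each result arises from at most r_u r_v choices.
--   Lower bound: in a graph without uv, replace ux, vy, ab by uv, xa, yb.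
-- There are r_u r_v choices of (x , y), for each of them all but
-- 2J + 2Δ + 2Δ(H₂)Δ of the m oriented edges ab are suitable, and each
-- result arises from at most m² choices.
--   For fixed x, y, a, b a switching is a composition of edge toggles, hence
-- a permutation of the set of all graphs, which makes the double counting
-- a reindexing of sums. The counts leave slack in the constants of f and g.

module Submission where

open import Defs
open import Data.Bool using (Bool; true; false; not; if_then_else_)
open import Data.Bool.Properties using (not-involutive)
open import Data.Empty using (⊥-elim)
open import Data.Fin using (Fin; zero; suc)
open import Data.Fin.Subset using (Subset; inside; outside; ∣_∣)
open import Data.Fin.Subset.Properties using (_∈?_)
import Data.Integer as ℤ
import Data.Integer.Properties as ℤ
open import Data.List
  using (List; []; _∷_; _++_; map; filter; length; take; allFin; cartesianProduct; cartesianProductWith)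
open import Data.List.Properties using (map-tabulate; map-++)
open import Data.List.Relation.Unary.All using (All; []; _∷_)
open import Data.List.Relation.Unary.AllPairs using (AllPairs; []; _∷_)
open import Data.List.Relation.Unary.Sorted.TotalOrder.Properties using (Sorted⇒AllPairs)
import Data.List.Relation.Binary.Permutation.Propositional.Properties as ↭
import Data.List.Sort
open import Data.Nat using (ℕ; zero; suc)
import Data.Nat as ℕ
open import Data.Nat.Coprimality using (1-coprimeTo)
import Data.Nat.Coprimality as Coprimality
open import Data.Nat.ListAction using (sum)
open import Data.Nat.ListAction.Properties using (sum-++; sum-↭)
import Data.Nat.Properties as ℕ
open import Data.Nat.Tactic.RingSolver using (solve-∀)
open import Data.Product using (∃; _×_; _,_; proj₁; proj₂; uncurry)
open import Data.Rational.Solver using (module +-*-Solver)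
open import Data.Rational.Unnormalised using (mkℚᵘ; *≡*)
import Data.Rational.Unnormalised.Properties as ℚᵘ
open import Data.Sum using (_⊎_; inj₁; inj₂)
open import Data.Vec using (Vec; []; _∷_; lookup; updateAt; toList)
import Data.Vec as Vec
import Data.Vec.Properties as Vec
open import Function using (_∘_; id)
open import Level using (0ℓ)
open import Relation.Binary.Bundles using (DecTotalOrder)
open import Relation.Binary.Properties.DecTotalOrder ℕ.≤-decTotalOrder using (≥-decTotalOrder)
open import Relation.Binary.PropositionalEquality
  using (_≡_; _≢_; refl; sym; trans; cong; cong₂; subst; subst₂; module ≡-Reasoning)
open import Relation.Nullary using (¬_; Dec; yes; no; does; _×-dec_; _⊎-dec_; ¬?; contradiction)
open import Relation.Unary using (Pred; Decidable)
open import Relation.Unary.Properties using (_∩?_)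

module _ where

  open import Algebra.Properties.CommutativeSemigroup ℕ.+-commutativeSemigroup using (interchange)
  open import Data.Fin using (_≟_)
  open import Data.Nat using (_+_; _*_; _∸_; _≤_; _≥_; z≤n; s≤s)
  open import Data.Nat.Properties hiding (_≟_)
  open Data.List.Sort ≥-decTotalOrder using (sort-↭; sort-↗)

  private variable
    X Y Z T : Set
    n : ℕ

  -- Finite sums over lists and indicators of decidable propositions.

  ∑ : List X → (X → ℕ) → ℕ
  ∑ xs f = sum (map f xs)

  syntax ∑ xs (λ x → e) = ∑[ x ∈ xs ] e

  𝟙 : ∀ {P : Set} → Dec P → ℕ
  𝟙 P? = if does P? then 1 else 0

  𝟙-mono : ∀ {P Q : Set} (P? : Dec P) (Q? : Dec Q) → (P → Q) → 𝟙 P? ≤ 𝟙 Q?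
  𝟙-mono (no _)  _        _ = z≤n
  𝟙-mono (yes p) (yes _)  _ = ≤-refl
  𝟙-mono (yes p) (no ¬q) pq = ⊥-elim (¬q (pq p))

  𝟙-cong : ∀ {P Q : Set} (P? : Dec P) (Q? : Dec Q) → (P → Q) → (Q → P) → 𝟙 P? ≡ 𝟙 Q?
  𝟙-cong P? Q? pq qp = ≤-antisym (𝟙-mono P? Q? pq) (𝟙-mono Q? P? qp)

  𝟙-× : ∀ {P Q : Set} (P? : Dec P) (Q? : Dec Q) → 𝟙 (P? ×-dec Q?) ≡ 𝟙 P? * 𝟙 Q?
  𝟙-× (no _)  Q? = refl
  𝟙-× (yes _) Q? = sym (*-identityˡ _)

  𝟙-yes : ∀ {P : Set} (P? : Dec P) → P → 1 ≤ 𝟙 P?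
  𝟙-yes (yes _) _ = ≤-refl
  𝟙-yes (no ¬p) p = ⊥-elim (¬p p)

  𝟙*-mono : ∀ {P : Set} (P? : Dec P) {a b} → (P → a ≤ b) → 𝟙 P? * a ≤ 𝟙 P? * b
  𝟙*-mono (yes p) a≤b = *-monoʳ-≤ 1 (a≤b p)
  𝟙*-mono (no _)  _   = z≤n

  𝟙-split : ∀ {P Q : Set} (P? : Dec P) (Q? : Dec Q) →
            𝟙 P? ≡ 𝟙 (P? ×-dec Q?) + 𝟙 (P? ×-dec ¬? Q?)
  𝟙-split (no _)  _       = refl
  𝟙-split (yes _) (yes _) = refl
  𝟙-split (yes _) (no _)  = refl

  -- A union bound: a failure of `Q` is charged to `a` and a failure of `R` to `b`, so bad choices
  -- can be counted by summing the charges.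
  𝟙≤𝟙-×+ : ∀ {P Q R : Set} (P? : Dec P) (Q? : Dec Q) (R? : Dec R) {a b} →
    (P → ¬ Q → 1 ≤ a) → (P → ¬ R → 1 ≤ b) → 𝟙 P? ≤ 𝟙 (P? ×-dec (Q? ×-dec R?)) + (a + b)
  𝟙≤𝟙-×+ (no _)  _       _       _   _   = z≤n
  𝟙≤𝟙-×+ (yes p) (yes _) (yes _) _   _   = s≤s z≤n
  𝟙≤𝟙-×+ (yes p) (yes _) (no ¬r) _   1≤b = ≤-trans (1≤b p ¬r) (m≤n+m _ _)
  𝟙≤𝟙-×+ (yes p) (no ¬q) _       1≤a _   = ≤-trans (1≤a p ¬q) (m≤m+n _ _)

  𝟙*-cong : ∀ {P : Set} (P? : Dec P) {a b} → (P → a ≡ b) → 𝟙 P? * a ≡ 𝟙 P? * b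
  𝟙*-cong (yes p) a≡b = cong (1 *_) (a≡b p)
  𝟙*-cong (no _)  _   = refl

  -- Turns the correctness of a switching into the inequality of weights that `∑-transfer` asks for.
  -- `S` and `T` stay separate factors, so that a sum over two independent choices can be factored
  -- afterwards.
  𝟙-×-mono : ∀ {P Q R S T : Set} (P? : Dec P) (Q? : Dec Q) (R? : Dec R) (S? : Dec S) (T? : Dec T) →
    (P → Q → R × (S × T)) → 𝟙 P? * 𝟙 Q? ≤ 𝟙 R? * (𝟙 S? * 𝟙 T?)
  𝟙-×-mono P? Q? R? S? T? f = begin
    𝟙 P? * 𝟙 Q?                      ≡⟨ 𝟙-× P? Q? ⟨
    𝟙 (P? ×-dec Q?)                  ≤⟨ 𝟙-mono (P? ×-dec Q?) (R? ×-dec (S? ×-dec T?)) (uncurry f) ⟩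
    𝟙 (R? ×-dec (S? ×-dec T?))       ≡⟨ 𝟙-× R? (S? ×-dec T?) ⟩
    𝟙 R? * 𝟙 (S? ×-dec T?)           ≡⟨ cong (𝟙 R? *_) (𝟙-× S? T?) ⟩
    𝟙 R? * (𝟙 S? * 𝟙 T?)             ∎
    where open ≤-Reasoning

  ∑-mono : ∀ (xs : List X) {f g : X → ℕ} → (∀ x → f x ≤ g x) → ∑ xs f ≤ ∑ xs g
  ∑-mono []       f≤g = z≤n
  ∑-mono (x ∷ xs) f≤g = +-mono-≤ (f≤g x) (∑-mono xs f≤g)

  ∑-cong : ∀ (xs : List X) {f g : X → ℕ} → (∀ x → f x ≡ g x) → ∑ xs f ≡ ∑ xs g
  ∑-cong []       f≡g = refl
  ∑-cong (x ∷ xs) f≡g = cong₂ _+_ (f≡g x) (∑-cong xs f≡g)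

  ∑-zero : ∀ (xs : List X) → ∑[ x ∈ xs ] 0 ≡ 0
  ∑-zero []       = refl
  ∑-zero (x ∷ xs) = ∑-zero xs

  ∑-+ : ∀ (xs : List X) (f g : X → ℕ) → ∑[ x ∈ xs ] (f x + g x) ≡ ∑ xs f + ∑ xs g
  ∑-+ []       f g = refl
  ∑-+ (x ∷ xs) f g rewrite ∑-+ xs f g = interchange (f x) (g x) (∑ xs f) (∑ xs g)

  ∑-*ˡ : ∀ (xs : List X) c (f : X → ℕ) → ∑[ x ∈ xs ] (c * f x) ≡ c * ∑ xs f
  ∑-*ˡ []       c f = sym (*-zeroʳ c)
  ∑-*ˡ (x ∷ xs) c f rewrite ∑-*ˡ xs c f = sym (*-distribˡ-+ c (f x) (∑ xs f))

  ∑-*ʳ : ∀ (xs : List X) (f : X → ℕ) c → ∑[ x ∈ xs ] (f x * c) ≡ ∑ xs f * c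
  ∑-*ʳ xs f c = trans (∑-cong xs λ x → *-comm (f x) c)
                      (trans (∑-*ˡ xs c f) (*-comm c (∑ xs f)))

  ∑-swap : ∀ (xs : List X) (ys : List Y) (f : X → Y → ℕ) →
           ∑[ x ∈ xs ] ∑[ y ∈ ys ] f x y ≡ ∑[ y ∈ ys ] ∑[ x ∈ xs ] f x y
  ∑-swap []       ys f = sym (∑-zero ys)
  ∑-swap (x ∷ xs) ys f =
    trans (cong (∑ ys (f x) +_) (∑-swap xs ys f))
          (sym (∑-+ ys (f x) λ y → ∑[ x ∈ xs ] f x y))

  ∑-++ : ∀ (xs ys : List X) (f : X → ℕ) → ∑ (xs ++ ys) f ≡ ∑ xs f + ∑ ys f
  ∑-++ xs ys f = trans (cong sum (map-++ f xs ys)) (sum-++ (map f xs) (map f ys))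

  ∑-map : ∀ (xs : List X) (h : X → Y) (f : Y → ℕ) → ∑ (map h xs) f ≡ ∑ xs (f ∘ h)
  ∑-map []       h f = refl
  ∑-map (x ∷ xs) h f = cong (f (h x) +_) (∑-map xs h f)

  ∑-cartesianProductWith : ∀ (h : X → Y → Z) xs ys (f : Z → ℕ) →
    ∑ (cartesianProductWith h xs ys) f ≡ ∑[ x ∈ xs ] ∑[ y ∈ ys ] f (h x y)
  ∑-cartesianProductWith h []       ys f = refl
  ∑-cartesianProductWith h (x ∷ xs) ys f =
    trans (∑-++ (map (h x) ys) _ f)
          (cong₂ _+_ (∑-map ys (h x) f) (∑-cartesianProductWith h xs ys f))

  ∑-*-∑ : ∀ (xs : List X) (ys : List Y) (f : X → ℕ) (g : Y → ℕ) →
          ∑[ x ∈ xs ] ∑[ y ∈ ys ] (f x * g y) ≡ ∑ xs f * ∑ ys g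
  ∑-*-∑ xs ys f g = trans (∑-cong xs λ x → ∑-*ˡ ys (f x) g) (∑-*ʳ xs f (∑ ys g))

  ∑-filter : ∀ {P : Pred X 0ℓ} (P? : Decidable P) (xs : List X) (f : X → ℕ) →
             ∑ (filter P? xs) f ≡ ∑[ x ∈ xs ] (𝟙 (P? x) * f x)
  ∑-filter P? []       f = refl
  ∑-filter P? (x ∷ xs) f with P? x
  ... | yes _ = cong₂ _+_ (sym (+-identityʳ (f x))) (∑-filter P? xs f)
  ... | no _  = ∑-filter P? xs f

  length-filter-∑ : ∀ {P : Pred X 0ℓ} (P? : Decidable P) (xs : List X) →
                    length (filter P? xs) ≡ ∑[ x ∈ xs ] 𝟙 (P? x)
  length-filter-∑ P? []       = refl
  length-filter-∑ P? (x ∷ xs) with P? x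
  ... | yes _ = cong suc (length-filter-∑ P? xs)
  ... | no _  = length-filter-∑ P? xs

  ∑-allFin-suc : ∀ n (f : Fin (suc n) → ℕ) →
                 ∑ (allFin (suc n)) f ≡ f zero + ∑[ i ∈ allFin n ] f (suc i)
  -- The tail of `allFin (suc n)` is `tabulate suc`, not `map suc (allFin n)`; both sides are
  -- brought to `tabulate (f ∘ suc)`.
  ∑-allFin-suc n f = cong (f zero +_) (cong sum
    (trans (map-tabulate suc f) (sym (map-tabulate id (f ∘ suc)))))

  ∑-𝟙-≟ : ∀ (p : Fin n) → ∑[ i ∈ allFin n ] 𝟙 (p ≟ i) ≡ 1
  ∑-𝟙-≟ {suc n} zero    = trans (∑-allFin-suc n λ i → 𝟙 (zero ≟ i)) (cong suc (∑-zero (allFin n)))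
  ∑-𝟙-≟ {suc n} (suc p) = trans (∑-allFin-suc n λ i → 𝟙 (suc p ≟ i)) (∑-𝟙-≟ p)

  ∣∷∣ : ∀ b (s : Subset n) → ∣ b ∷ s ∣ ≡ (if b then 1 else 0) + ∣ s ∣
  ∣∷∣ false s = refl
  ∣∷∣ true  s = refl

  -- Edge toggles

  -- On the diagonal the graph is left unchanged, so every pair `p`, `q` gives a permutation of the
  -- graphs and sums can be reindexed without side conditions.
  toggle : Fin n → Fin n → Graph n → Graph n
  toggle zero    zero    (s ▹ G) = s ▹ G
  toggle zero    (suc q) (s ▹ G) = updateAt s q not ▹ G
  toggle (suc p) zero    (s ▹ G) = updateAt s p not ▹ G
  toggle (suc p) (suc q) (s ▹ G) = s ▹ toggle p q G

  -- Flipping position zero exchanges the two halves of `subsets (suc n)`; any other flip acts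
  -- inside each half.
  ∑-subsets-flip : ∀ (p : Fin n) (w : Subset n → ℕ) →
                   ∑[ s ∈ subsets n ] w (updateAt s p not) ≡ ∑ (subsets n) w
  ∑-subsets-flip {suc n} p w = trans (∑-subsets _) (trans (go p) (sym (∑-subsets w)))
    where
    ∑-subsets : ∀ (w : Subset (suc n) → ℕ) → ∑ (subsets (suc n)) w ≡
                ∑[ s ∈ subsets n ] w (outside ∷ s) + ∑[ s ∈ subsets n ] w (inside ∷ s)
    ∑-subsets w = trans (∑-cartesianProductWith _∷_ (outside ∷ inside ∷ []) (subsets n) w)
                        (cong (∑ (subsets n) (w ∘ (outside ∷_)) +_) (+-identityʳ _))
    go : ∀ p → ∑[ s ∈ subsets n ] w (updateAt (outside ∷ s) p not)
               + ∑[ s ∈ subsets n ] w (updateAt (inside ∷ s) p not) ≡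
               ∑[ s ∈ subsets n ] w (outside ∷ s) + ∑[ s ∈ subsets n ] w (inside ∷ s)
    go zero    = +-comm (∑[ s ∈ subsets n ] w (inside ∷ s)) _
    go (suc p) = cong₂ _+_ (∑-subsets-flip p (w ∘ (outside ∷_))) (∑-subsets-flip p (w ∘ (inside ∷_)))

  -- The sum runs over all graphs and not only over those with degree sequence `d`: a single toggle
  -- can change degrees, and only a whole switching restores them. The degree condition is therefore
  -- left to the weight `w`.
  ∑-graphs-toggle : ∀ (p q : Fin n) (w : Graph n → ℕ) →
                    ∑[ G ∈ graphs n ] w (toggle p q G) ≡ ∑ (graphs n) w
  ∑-graphs-toggle {suc n} p q w =
    trans (∑-graphs (w ∘ toggle p q)) (trans (go p q) (sym (∑-graphs w)))
    where
    ∑-graphs : ∀ (w : Graph (suc n) → ℕ) → ∑ (graphs (suc n)) w ≡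
               ∑[ s ∈ subsets n ] ∑[ G ∈ graphs n ] w (s ▹ G)
    ∑-graphs = ∑-cartesianProductWith _▹_ (subsets n) (graphs n)
    go : ∀ p q → ∑[ s ∈ subsets n ] ∑[ G ∈ graphs n ] w (toggle p q (s ▹ G)) ≡
                 ∑[ s ∈ subsets n ] ∑[ G ∈ graphs n ] w (s ▹ G)
    go zero    zero    = refl
    go zero    (suc q) = ∑-subsets-flip q λ s → ∑[ G ∈ graphs n ] w (s ▹ G)
    go (suc p) zero    = ∑-subsets-flip p λ s → ∑[ G ∈ graphs n ] w (s ▹ G)
    go (suc p) (suc q) = ∑-cong (subsets n) λ s → ∑-graphs-toggle p q (w ∘ (s ▹_))

  -- Adjacency before and after a toggle.

  Adj-sym : ∀ (G : Graph n) {i j} → Adj G i j → Adj G j i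
  Adj-sym G {i} {j} ij =
    Vec.lookup⇒[]= i _ (trans (sym (adj-sym G i j)) (Vec.[]=⇒lookup ij))

  Adj-irrefl : ∀ (G : Graph n) {i j} → Adj G i j → i ≢ j
  Adj-irrefl G {i} ii refl with trans (sym (adj-irrefl G i)) (Vec.[]=⇒lookup ii)
  ... | ()

  SameEdge : (p q i j : Fin n) → Set
  SameEdge p q i j = (i ≡ p × j ≡ q) ⊎ (i ≡ q × j ≡ p)

  sameEdge? : ∀ (p q i j : Fin n) → Dec (SameEdge p q i j)
  sameEdge? p q i j = ((i ≟ p) ×-dec (j ≟ q)) ⊎-dec ((i ≟ q) ×-dec (j ≟ p))

  adj : Graph n → Fin n → Fin n → Bool
  adj G i j = lookup (neighbours G i) j

  adj-toggle-other : ∀ (G : Graph n) p q i j → ¬ SameEdge p q i j →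
                     adj (toggle p q G) i j ≡ adj G i j
  adj-toggle-other (s ▹ G) zero    zero    i       j       _ = refl
  adj-toggle-other (s ▹ G) zero    (suc q) zero    zero    _ = refl
  adj-toggle-other (s ▹ G) zero    (suc q) zero    (suc j) ne =
    Vec.lookup∘updateAt′ j q (λ j≡q → ne (inj₁ (refl , cong suc j≡q))) s
  adj-toggle-other (s ▹ G) zero    (suc q) (suc i) zero    ne =
    Vec.lookup∘updateAt′ i q (λ i≡q → ne (inj₂ (cong suc i≡q , refl))) s
  adj-toggle-other (s ▹ G) zero    (suc q) (suc i) (suc j) ne = refl
  adj-toggle-other (s ▹ G) (suc p) zero    zero    zero    _ = refl
  adj-toggle-other (s ▹ G) (suc p) zero    zero    (suc j) ne =
    Vec.lookup∘updateAt′ j p (λ j≡p → ne (inj₂ (refl , cong suc j≡p))) s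
  adj-toggle-other (s ▹ G) (suc p) zero    (suc i) zero    ne =
    Vec.lookup∘updateAt′ i p (λ i≡p → ne (inj₁ (cong suc i≡p , refl))) s
  adj-toggle-other (s ▹ G) (suc p) zero    (suc i) (suc j) ne = refl
  adj-toggle-other (s ▹ G) (suc p) (suc q) zero    j       ne = refl
  adj-toggle-other (s ▹ G) (suc p) (suc q) (suc i) zero    ne = refl
  adj-toggle-other (s ▹ G) (suc p) (suc q) (suc i) (suc j) ne =
    adj-toggle-other G p q i j λ where
      (inj₁ (refl , refl)) → ne (inj₁ (refl , refl))
      (inj₂ (refl , refl)) → ne (inj₂ (refl , refl))

  adj-toggle-same : ∀ (G : Graph n) {p q} → p ≢ q → adj (toggle p q G) p q ≡ not (adj G p q)
  adj-toggle-same (s ▹ G) {zero}  {zero}  p≢q = ⊥-elim (p≢q refl)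
  adj-toggle-same (s ▹ G) {zero}  {suc q} p≢q = Vec.lookup∘updateAt q s
  adj-toggle-same (s ▹ G) {suc p} {zero}  p≢q = Vec.lookup∘updateAt p s
  adj-toggle-same (s ▹ G) {suc p} {suc q} p≢q = adj-toggle-same G (p≢q ∘ cong suc)

  adj-false : ∀ (G : Graph n) {i j} → ¬ Adj G i j → adj G i j ≡ false
  adj-false G {i} {j} ¬ij with adj G i j in eq
  ... | false = refl
  ... | true  = ⊥-elim (¬ij (Vec.lookup⇒[]= j _ eq))

  module _ (G : Graph n) {p q : Fin n} where

    toggle-on : p ≢ q → ¬ Adj G p q → Adj (toggle p q G) p q
    toggle-on p≢q ¬pq = Vec.lookup⇒[]= q _
      (trans (adj-toggle-same G p≢q) (cong not (adj-false G ¬pq)))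

    toggle-off : Adj G p q → ¬ Adj (toggle p q G) p q
    toggle-off pq pq′ with trans (sym (Vec.[]=⇒lookup pq′))
      (trans (adj-toggle-same G (Adj-irrefl G pq)) (cong not (Vec.[]=⇒lookup pq)))
    ... | ()

    toggle-other⁺ : ∀ {i j} → ¬ SameEdge p q i j → Adj G i j → Adj (toggle p q G) i j
    toggle-other⁺ {i} {j} ne ij = Vec.lookup⇒[]= j _
      (trans (adj-toggle-other G p q i j ne) (Vec.[]=⇒lookup ij))

    toggle-other⁻ : ∀ {i j} → ¬ SameEdge p q i j → Adj (toggle p q G) i j → Adj G i j
    toggle-other⁻ {i} {j} ne ij = Vec.lookup⇒[]= j _
      (trans (sym (adj-toggle-other G p q i j ne)) (Vec.[]=⇒lookup ij))

    toggle-adds : ¬ Adj G p q → ∀ {i j} → Adj G i j → Adj (toggle p q G) i j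
    toggle-adds ¬pq ij = toggle-other⁺ (λ where
      (inj₁ (refl , refl)) → ¬pq ij
      (inj₂ (refl , refl)) → ¬pq (Adj-sym G ij)) ij

    toggle-removes : Adj G p q → ∀ {i j} → Adj (toggle p q G) i j → Adj G i j
    toggle-removes pq {i} {j} ij with sameEdge? p q i j
    ... | yes (inj₁ (refl , refl)) = pq
    ... | yes (inj₂ (refl , refl)) = Adj-sym G pq
    ... | no ne = toggle-other⁻ ne ij

    ⊆ᴳ-toggle : ∀ (H : Graph n) → ¬ Adj H p q → H ⊆ᴳ G → H ⊆ᴳ toggle p q G
    ⊆ᴳ-toggle H ¬pq H⊆G i ij = toggle-other⁺ (λ where
      (inj₁ (refl , refl)) → ¬pq ij
      (inj₂ (refl , refl)) → ¬pq (Adj-sym H ij)) (H⊆G i ij)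

    disjoint-toggle : ∀ (H : Graph n) → ¬ Adj H p q → EdgeDisjoint H G →
                      EdgeDisjoint H (toggle p q G)
    disjoint-toggle H ¬pq dis i j (ijᴴ , ij) = dis i j (ijᴴ , toggle-other⁻ (λ where
      (inj₁ (refl , refl)) → ¬pq ijᴴ
      (inj₂ (refl , refl)) → ¬pq (Adj-sym H ijᴴ)) ij)

  -- Involutivity of toggles and their effect on degrees.

  flip-involutive : ∀ (s : Subset n) q → updateAt (updateAt s q not) q not ≡ s
  flip-involutive s q =
    trans (Vec.updateAt-updateAt q s) (Vec.updateAt-id-local q s (not-involutive (lookup s q)))

  toggle-involutive : ∀ (p q : Fin n) (G : Graph n) → toggle p q (toggle p q G) ≡ G
  toggle-involutive zero    zero    (s ▹ G) = refl
  toggle-involutive zero    (suc q) (s ▹ G) = cong (_▹ G) (flip-involutive s q)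
  toggle-involutive (suc p) zero    (s ▹ G) = cong (_▹ G) (flip-involutive s p)
  toggle-involutive (suc p) (suc q) (s ▹ G) = cong (s ▹_) (toggle-involutive p q G)

  δ : Fin n → Fin n → ℕ
  δ p i = 𝟙 (p ≟ i)

  ∣flip∣ : ∀ (s : Subset n) q → lookup s q ≡ false → ∣ updateAt s q not ∣ ≡ suc ∣ s ∣
  ∣flip∣ (false ∷ s) zero    _  = refl
  ∣flip∣ (b ∷ s)     (suc q) eq = begin
    ∣ b ∷ updateAt s q not ∣                        ≡⟨ ∣∷∣ b (updateAt s q not) ⟩
    (if b then 1 else 0) + ∣ updateAt s q not ∣
      ≡⟨ cong ((if b then 1 else 0) +_) (∣flip∣ s q eq) ⟩
    (if b then 1 else 0) + suc ∣ s ∣                ≡⟨ +-suc _ _ ⟩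
    suc ((if b then 1 else 0) + ∣ s ∣)              ≡⟨ cong suc (∣∷∣ b s) ⟨
    suc ∣ b ∷ s ∣                                   ∎
    where open ≡-Reasoning

  ∣∷∣-flip : ∀ {m} (s : Subset m) (t : Subset n) q i → lookup s q ≡ false →
             ∣ lookup (updateAt s q not) i ∷ t ∣ ≡ ∣ lookup s i ∷ t ∣ + δ q i
  ∣∷∣-flip s t q i eq with q ≟ i
  ... | yes refl rewrite Vec.lookup∘updateAt q {not} s | eq = +-comm 1 ∣ t ∣
  ... | no q≢i   rewrite Vec.lookup∘updateAt′ i q {not} (q≢i ∘ sym) s = sym (+-identityʳ _)

  deg-toggle : ∀ (G : Graph n) {p q} → p ≢ q → adj G p q ≡ false →
               ∀ i → deg (toggle p q G) i ≡ deg G i + (δ p i + δ q i)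
  deg-toggle (s ▹ G) {zero}  {zero}  p≢q _  _       = ⊥-elim (p≢q refl)
  deg-toggle (s ▹ G) {zero}  {suc q} p≢q eq zero    = trans (∣flip∣ s q eq) (+-comm 1 ∣ s ∣)
  deg-toggle (s ▹ G) {zero}  {suc q} p≢q eq (suc i) = ∣∷∣-flip s (neighbours G i) q i eq
  deg-toggle (s ▹ G) {suc p} {zero}  p≢q eq zero    = trans (∣flip∣ s p eq) (+-comm 1 ∣ s ∣)
  deg-toggle (s ▹ G) {suc p} {zero}  p≢q eq (suc i) =
    trans (∣∷∣-flip s (neighbours G i) p i eq)
          (cong (∣ lookup s i ∷ neighbours G i ∣ +_) (sym (+-identityʳ (δ p i))))
  deg-toggle (s ▹ G) {suc p} {suc q} p≢q eq zero    = sym (+-identityʳ ∣ s ∣)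
  deg-toggle (s ▹ G) {suc p} {suc q} p≢q eq (suc i) = begin
    ∣ lookup s i ∷ neighbours (toggle p q G) i ∣
      ≡⟨ ∣∷∣ (lookup s i) (neighbours (toggle p q G) i) ⟩
    b + deg (toggle p q G) i
      ≡⟨ cong (b +_) (deg-toggle G (p≢q ∘ cong suc) eq i) ⟩
    b + (deg G i + (δ p i + δ q i))                      ≡⟨ +-assoc b _ _ ⟨
    (b + deg G i) + (δ p i + δ q i)                      ≡⟨ cong (_+ (δ p i + δ q i)) (∣∷∣ (lookup s i) (neighbours G i)) ⟨
    ∣ lookup s i ∷ neighbours G i ∣ + (δ p i + δ q i)    ∎
    where
    open ≡-Reasoning
    b = if lookup s i then 1 else 0

  module _ (G : Graph n) {p q : Fin n} where

    deg-add : p ≢ q → ¬ Adj G p q → ∀ i → deg (toggle p q G) i ≡ deg G i + (δ p i + δ q i)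
    deg-add p≢q ¬pq = deg-toggle G p≢q (adj-false G ¬pq)

    -- A second toggle restores `G`, so a removal is an insertion read backwards. The additive form
    -- avoids truncated subtraction.
    deg-remove : Adj G p q → ∀ i → deg G i ≡ deg (toggle p q G) i + (δ p i + δ q i)
    deg-remove pq i = subst (λ K → deg K i ≡ deg (toggle p q G) i + (δ p i + δ q i))
      (toggle-involutive p q G)
      (deg-toggle (toggle p q G) (Adj-irrefl G pq) (adj-false (toggle p q G) (toggle-off G pq)) i)

  -- Bounding weighted degree sums by `J`.

  -- A threshold t separating the k largest entries turns the sum of those
  -- into a permutation-invariant expression.
  take-threshold : ∀ k (ys : List ℕ) → AllPairs _≥_ ys →
    ∃ λ t → (∀ b → All (_≤ b) ys → t ≤ b) ×
            k * t + ∑[ y ∈ ys ] (y ∸ t) ≤ sum (take k ys)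
  take-threshold k [] _ = 0 , (λ _ _ → z≤n) ,
    ≤-reflexive (trans (+-identityʳ (k * 0)) (trans (*-zeroʳ k) (sym (cong sum (take-[] k)))))
    where
    take-[] : ∀ k → take k [] ≡ ([] {A = ℕ})
    take-[] zero    = refl
    take-[] (suc k) = refl
  take-threshold zero (y ∷ ys) (y≥ ∷ _) =
    -- With nothing to take, the largest entry is the threshold: every excess over it vanishes.
    y , (λ { b (y≤b ∷ _) → y≤b }) , ≤-reflexive (cong₂ _+_ (n∸n≡0 y) (none ys y≥))
    where
    none : ∀ ys → All (_≤ y) ys → ∑[ z ∈ ys ] (z ∸ y) ≡ 0
    none []       []         = refl
    none (z ∷ zs) (z≤y ∷ p) = cong₂ _+_ (m≤n⇒m∸n≡0 z≤y) (none zs p)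
  take-threshold (suc k) (y ∷ ys) (y≥ ∷ sorted) with take-threshold k ys sorted
  -- The head `y` bounds the tail, so the invariant `t≤` gives `t ≤ y`, and `y` splits exactly into
  -- `t` and its excess.
  ... | t , t≤ , bound = t , (λ { b (_ ∷ ys≤b) → t≤ b ys≤b }) , (begin
    (t + k * t) + ((y ∸ t) + S)    ≡⟨ interchange t (k * t) (y ∸ t) S ⟩
    (t + (y ∸ t)) + (k * t + S)    ≡⟨ cong (_+ (k * t + S)) (m+[n∸m]≡n (t≤ y y≥)) ⟩
    y + (k * t + S)                ≤⟨ +-monoʳ-≤ y bound ⟩
    y + sum (take k ys)            ∎)
    where
    open ≤-Reasoning
    S = ∑[ z ∈ ys ] (z ∸ t)

  ∑-lookup-toList : ∀ {n} (d : Vec ℕ n) (f : ℕ → ℕ) → ∑[ i ∈ allFin n ] f (lookup d i) ≡ ∑ (toList d) f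
  ∑-lookup-toList []      f = refl
  ∑-lookup-toList (x ∷ d) f = trans (∑-allFin-suc _ λ i → f (lookup (x ∷ d) i)) (cong (f x +_) (∑-lookup-toList d f))

  ∑-lookup≡sum : ∀ {n} (d : Vec ℕ n) → ∑[ i ∈ allFin n ] lookup d i ≡ Vec.sum d
  ∑-lookup≡sum []      = refl
  ∑-lookup≡sum (x ∷ d) = trans (∑-allFin-suc _ (lookup (x ∷ d))) (cong (x +_) (∑-lookup≡sum d))

  lookup≤maximum : ∀ {n} (d : Vec ℕ n) i → lookup d i ≤ maximum d
  lookup≤maximum (x ∷ d) zero    = m≤m⊔n x _
  lookup≤maximum (x ∷ d) (suc i) = ≤-trans (lookup≤maximum d i) (m≤n⊔m x _)

  -- Each entry is at most `t` plus its excess over `t`. Total weight at most Δ bounds the first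
  -- parts by Δ times `t`, and weights at most 1 bound the rest by the sum of all excesses, which
  -- sorting does not change. The intended `c` is the indicator of a neighbourhood.
  weight≤1⇒∑≤J : ∀ {n} (d : Vec ℕ n) (c : Fin n → ℕ) → (∀ i → c i ≤ 1) →
                 ∑ (allFin n) c ≤ maximum d → ∑[ i ∈ allFin n ] (c i * lookup d i) ≤ J d
  weight≤1⇒∑≤J {n} d c c≤1 ∑c≤Δ with take-threshold (maximum d) (sortDescending (toList d))
      (Sorted⇒AllPairs (DecTotalOrder.totalOrder ≥-decTotalOrder) (sort-↗ (toList d)))
  ... | t , _ , bound = begin
    ∑[ i ∈ allFin n ] (c i * lookup d i)                        ≤⟨ ∑-mono (allFin n) pointwise ⟩
    ∑[ i ∈ allFin n ] (c i * t + (lookup d i ∸ t))              ≡⟨ ∑-+ (allFin n) _ _ ⟩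
    ∑[ i ∈ allFin n ] (c i * t) + ∑[ i ∈ allFin n ] (lookup d i ∸ t)
      ≡⟨ cong₂ _+_ (∑-*ʳ (allFin n) c t) (∑-lookup-toList d (_∸ t)) ⟩
    ∑ (allFin n) c * t + ∑[ x ∈ toList d ] (x ∸ t)
      ≤⟨ +-mono-≤ (*-monoˡ-≤ t ∑c≤Δ)
           (≤-reflexive (sym (sum-↭ (↭.map⁺ (_∸ t) (sort-↭ (toList d)))))) ⟩
    maximum d * t + ∑[ x ∈ sortDescending (toList d) ] (x ∸ t)  ≤⟨ bound ⟩
    J d                                                         ∎
    where
    open ≤-Reasoning
    pointwise : ∀ i → c i * lookup d i ≤ c i * t + (lookup d i ∸ t)
    pointwise i = begin
      c i * lookup d i                   ≤⟨ *-monoʳ-≤ (c i) (m≤n+m∸n (lookup d i) t) ⟩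
      c i * (t + (lookup d i ∸ t))       ≡⟨ *-distribˡ-+ (c i) t _ ⟩
      c i * t + c i * (lookup d i ∸ t)
        ≤⟨ +-monoʳ-≤ (c i * t) (*-monoˡ-≤ (lookup d i ∸ t) (c≤1 i)) ⟩
      c i * t + 1 * (lookup d i ∸ t)     ≡⟨ cong (c i * t +_) (*-identityˡ _) ⟩
      c i * t + (lookup d i ∸ t)         ∎

  -- Switchings

  module Switching {n} (d : Vec ℕ n) (H₁ H₂ : Graph n) where

    Respects : Graph n → Set
    Respects G = H₁ ⊆ᴳ G × EdgeDisjoint H₂ G

    Admissible : Graph n → Set
    Admissible G = degrees G ≡ d × Respects G

    admissible? : ∀ G → Dec (Admissible G)
    admissible? G = realises? d G ×-dec (contains? H₁ G ×-dec avoids? H₂ G)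

    -- The edges that a switching may remove while keeping `H₁`.
    Loose : Graph n → Fin n → Fin n → Set
    Loose G i j = Adj G i j × ¬ Adj H₁ i j

    loose? : ∀ G i j → Dec (Loose G i j)
    loose? G i j = Adj? i j G ×-dec ¬? (Adj? i j H₁)

    -- The pairs that a switching may insert while staying simple and avoiding `H₂`.
    Free : Graph n → Fin n → Fin n → Set
    Free G p a = p ≢ a × (¬ Adj G p a × ¬ Adj H₂ p a)

    free? : ∀ G p a → Dec (Free G p a)
    free? G p a = ¬? (p ≟ a) ×-dec (¬? (Adj? p a G) ×-dec ¬? (Adj? p a H₂))

    -- The edge `ab` may be traded for `pa` and `qb`. One notion serves both bounds: `p`, `q` are
    -- `u`, `v` in `switch₂` and `x`, `y` in `switch₃`.
    Switchable : Graph n → Fin n → Fin n → Fin n → Fin n → Set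
    Switchable G p q a b = Loose G a b × (Free G p a × Free G q b)

    switchable? : ∀ G p q a b → Dec (Switchable G p q a b)
    switchable? G p q a b = loose? G a b ×-dec (free? G p a ×-dec free? G q b)

    module _ {G : Graph n} (adm : Admissible G) {i j : Fin n} where

      loose⇒∉H₂ : Loose G i j → ¬ Adj H₂ i j
      loose⇒∉H₂ (ij , _) ijᴴ = proj₂ (proj₂ adm) i j (ijᴴ , ij)

      ∉⇒∉H₁ : ¬ Adj G i j → ¬ Adj H₁ i j
      ∉⇒∉H₁ ¬ij ijᴴ = ¬ij (proj₁ (proj₂ adm) i ijᴴ)

    respects-toggle : ∀ {G p q} → ¬ Adj H₁ p q → ¬ Adj H₂ p q →
                      Respects G → Respects (toggle p q G)
    respects-toggle {G} ∉₁ ∉₂ (con , avo) =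
      ⊆ᴳ-toggle G H₁ ∉₁ con , disjoint-toggle G H₂ ∉₂ avo

    -- Read from the right, removals precede insertions here and in `switch₃`. The graph between the
    -- two phases is then a subgraph of `G`, and non-edges of `G` are still absent from it.
    switch₂ : (u v x y : Fin n) → Graph n → Graph n
    switch₂ u v x y = toggle v y ∘ toggle u x ∘ toggle x y ∘ toggle u v

    switch₃ : (u v x y a b : Fin n) → Graph n → Graph n
    switch₃ u v x y a b =
      toggle y b ∘ toggle x a ∘ toggle u v ∘ toggle a b ∘ toggle v y ∘ toggle u x

    private
      rearrange₁ : ∀ g u v x y → (g + (u + x)) + (v + y) ≡ (g + (x + y)) + (u + v)
      rearrange₁ = solve-∀

      rearrange₂ : ∀ g u v x y a b → ((g + (u + v)) + (x + a)) + (y + b) ≡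
                                     ((g + (a + b)) + (v + y)) + (u + x)
      rearrange₂ = solve-∀

    module _ (u v : Fin n) (∉H₁ : ¬ Adj H₁ u v) (∉H₂ : ¬ Adj H₂ u v) where

      -- The point is that no toggle undoes another: each coincidence among `uv`, `xy`, `ux`, `vy`
      -- contradicts looseness, freeness or irreflexivity. That `ux` and `vy` are loose in the
      -- result is what limits the preimages to `r u * r v`.
      switch₂-correct : ∀ x y {G} → Admissible G × Adj G u v → Switchable G u v x y →
        (Admissible (switch₂ u v x y G) × ¬ Adj (switch₂ u v x y G) u v) ×
        (Loose (switch₂ u v x y G) u x × Loose (switch₂ u v x y G) v y)
      switch₂-correct x y {G} (adm , uv) (xyL@(xy , xy∉₁) , (u≢x , ¬ux , ux∉₂) , (v≢y , ¬vy , vy∉₂)) =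
        ((trans (Vec.tabulate-cong degs) (proj₁ adm) , respects) , ¬uv₄) ,
        (toggle-adds G₃ ¬vy₃ (toggle-on G₂ u≢x ¬ux₂) , ∉⇒∉H₁ adm ¬ux) ,
        (toggle-on G₃ v≢y ¬vy₃ , ∉⇒∉H₁ adm ¬vy)
        where
        G₁ = toggle u v G
        G₂ = toggle x y G₁
        G₃ = toggle u x G₂
        G₄ = toggle v y G₃

        xy₁ : Adj G₁ x y
        xy₁ = toggle-other⁺ G (λ where
          (inj₁ (refl , refl)) → u≢x refl
          (inj₂ (refl , refl)) → ¬ux uv) xy

        shrink : ∀ {i j} → Adj G₂ i j → Adj G i j
        shrink = toggle-removes G uv ∘ toggle-removes G₁ xy₁

        ¬ux₂ : ¬ Adj G₂ u x
        ¬ux₂ = ¬ux ∘ shrink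

        ¬vy₃ : ¬ Adj G₃ v y
        ¬vy₃ = ¬vy ∘ shrink ∘ toggle-other⁻ G₂ λ where
          (inj₁ (v≡u , _)) → Adj-irrefl G uv (sym v≡u)
          (inj₂ (refl , refl)) → ¬ux uv

        ¬uv₄ : ¬ Adj G₄ u v
        ¬uv₄ = toggle-off G uv ∘ toggle-removes G₁ xy₁ ∘
          toggle-other⁻ G₂ (λ where
            (inj₁ (refl , refl)) → ¬ux uv
            (inj₂ (refl , refl)) → u≢x refl) ∘
          toggle-other⁻ G₃ (λ where
            (inj₁ (u≡v , _)) → Adj-irrefl G uv u≡v
            (inj₂ (refl , _)) → ¬ux (Adj-sym G xy))

        -- Every toggled pair lies outside both `H₁` and `H₂`. An edge of `G` cannot be in `H₂` and
        -- a non-edge cannot be in `H₁`; looseness, freeness and the hypotheses on `uv` give the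
        -- other half.
        respects : Respects G₄
        respects =
          respects-toggle (∉⇒∉H₁ adm ¬vy) vy∉₂
          (respects-toggle (∉⇒∉H₁ adm ¬ux) ux∉₂
          (respects-toggle xy∉₁ (loose⇒∉H₂ adm xyL)
          (respects-toggle ∉H₁ ∉H₂ (proj₂ adm))))

        -- Both degrees are measured from `G₂`, to which `G` and `G₄` each add two edges with the
        -- same four endpoints.
        degs : ∀ i → deg G₄ i ≡ deg G i
        degs i
          rewrite deg-add G₃ v≢y ¬vy₃ i | deg-add G₂ u≢x ¬ux₂ i
                | deg-remove G uv i | deg-remove G₁ xy₁ i
                = rearrange₁ (deg G₂ i) (δ u i) (δ v i) (δ x i) (δ y i)

      -- The removed edges `ux`, `vy`, `ab` and the inserted `uv`, `xa`, `yb` cover the same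
      -- endpoints. Both `xa` and `yb` are loose in the result, which limits the preimages to
      -- `m * m`.
      switch₃-correct : u ≢ v → ∀ x y a b {G} → Admissible G × ¬ Adj G u v →
        Loose G u x × Loose G v y → Switchable G x y a b →
        (Admissible (switch₃ u v x y a b G) × Adj (switch₃ u v x y a b G) u v) ×
        (Loose (switch₃ u v x y a b G) x a × Loose (switch₃ u v x y a b G) y b)
      switch₃-correct u≢v x y a b {G} (adm , ¬uv) (uxL@(ux , ux∉₁) , vyL@(vy , vy∉₁))
        (abL@(ab , ab∉₁) , (x≢a , ¬xa , xa∉₂) , (y≢b , ¬yb , yb∉₂)) =
        ((trans (Vec.tabulate-cong degs) (proj₁ adm) , respects) ,
         toggle-adds G₅ ¬yb₅ (toggle-adds G₄ ¬xa₄ (toggle-on G₃ u≢v ¬uv₃))) ,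
        (toggle-adds G₅ ¬yb₅ (toggle-on G₄ x≢a ¬xa₄) , ∉⇒∉H₁ adm ¬xa) ,
        (toggle-on G₅ y≢b ¬yb₅ , ∉⇒∉H₁ adm ¬yb)
        where
        G₁ = toggle u x G
        G₂ = toggle v y G₁
        G₃ = toggle a b G₂
        G₄ = toggle u v G₃
        G₅ = toggle x a G₄
        G₆ = toggle y b G₅

        vy₁ : Adj G₁ v y
        vy₁ = toggle-other⁺ G (λ where
          (inj₁ (v≡u , _)) → u≢v (sym v≡u)
          (inj₂ (refl , refl)) → ¬uv ux) vy

        -- Freeness of `xa` separates `ab` from `ux`, and freeness of `yb` separates it from `vy`.
        ab₂ : Adj G₂ a b
        ab₂ = toggle-other⁺ G₁ (λ where
            (inj₁ (refl , refl)) → y≢b refl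
            (inj₂ (refl , refl)) → ¬yb (Adj-sym G vy))
          (toggle-other⁺ G (λ where
            (inj₁ (refl , refl)) → ¬xa (Adj-sym G ux)
            (inj₂ (refl , refl)) → x≢a refl) ab)

        shrink : ∀ {i j} → Adj G₃ i j → Adj G i j
        shrink = toggle-removes G ux ∘ toggle-removes G₁ vy₁ ∘ toggle-removes G₂ ab₂

        ¬uv₃ : ¬ Adj G₃ u v
        ¬uv₃ = ¬uv ∘ shrink

        ¬xa₄ : ¬ Adj G₄ x a
        ¬xa₄ = ¬xa ∘ shrink ∘ toggle-other⁻ G₃ λ where
          (inj₁ (refl , refl)) → Adj-irrefl G ux refl
          (inj₂ (refl , refl)) → ¬uv ux

        ¬yb₅ : ¬ Adj G₅ y b
        ¬yb₅ = ¬yb ∘ shrink ∘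
          toggle-other⁻ G₃ (λ where
            (inj₁ (refl , refl)) → ¬uv (Adj-sym G vy)
            (inj₂ (refl , refl)) → Adj-irrefl G vy refl) ∘
          toggle-other⁻ G₄ (λ where
            (inj₁ (refl , refl)) → Adj-irrefl G ab refl
            (inj₂ (refl , refl)) → ¬yb ab)

        respects : Respects G₆
        respects =
          respects-toggle (∉⇒∉H₁ adm ¬yb) yb∉₂
          (respects-toggle (∉⇒∉H₁ adm ¬xa) xa∉₂
          (respects-toggle ∉H₁ ∉H₂
          (respects-toggle ab∉₁ (loose⇒∉H₂ adm abL)
          (respects-toggle vy∉₁ (loose⇒∉H₂ adm vyL)
          (respects-toggle ux∉₁ (loose⇒∉H₂ adm uxL) (proj₂ adm))))))

        degs : ∀ i → deg G₆ i ≡ deg G i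
        degs i
          rewrite deg-add G₅ y≢b ¬yb₅ i | deg-add G₄ x≢a ¬xa₄ i | deg-add G₃ u≢v ¬uv₃ i
                | deg-remove G ux i | deg-remove G₁ vy₁ i | deg-remove G₂ ab₂ i
                = rearrange₂ (deg G₃ i) (δ u i) (δ v i) (δ x i) (δ y i) (δ a i) (δ b i)

  -- Counting switchings

  ∣∣-∑ : ∀ (s : Subset n) → ∣ s ∣ ≡ ∑[ j ∈ allFin n ] 𝟙 (j ∈? s)
  ∣∣-∑ []          = refl
  ∣∣-∑ {suc n} (false ∷ s) = trans (∣∣-∑ s) (sym (∑-allFin-suc n λ j → 𝟙 (j ∈? (false ∷ s))))
  ∣∣-∑ {suc n} (true ∷ s)  = trans (cong suc (∣∣-∑ s)) (sym (∑-allFin-suc n λ j → 𝟙 (j ∈? (true ∷ s))))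

  deg-∑ : ∀ (G : Graph n) i → ∑[ j ∈ allFin n ] 𝟙 (Adj? i j G) ≡ deg G i
  deg-∑ G i = sym (∣∣-∑ (neighbours G i))

  ∑-deg : ∀ (G : Graph n) → ∑ (allFin n) (deg G) ≡ 2 * edges G
  ∑-deg {n} G = begin
    ∑ (allFin n) (deg G)                         ≡⟨ ∑-cong (allFin n) (λ i → Vec.lookup∘tabulate (deg G) i) ⟨
    ∑[ i ∈ allFin n ] lookup (degrees G) i       ≡⟨ ∑-lookup≡sum (degrees G) ⟩
    Vec.sum (degrees G)                          ≡⟨ handshake G ⟩
    2 * edges G                                  ∎
    where open ≡-Reasoning

  pairs : ∀ n → List (Fin n × Fin n)
  pairs n = cartesianProduct (allFin n) (allFin n)

  ∑² : ∀ n → (Fin n × Fin n → ℕ) → ℕ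
  ∑² n = ∑ (pairs n)

  ∑²-∑∑ : ∀ (f : Fin n × Fin n → ℕ) → ∑² n f ≡ ∑[ i ∈ allFin n ] ∑[ j ∈ allFin n ] f (i , j)
  ∑²-∑∑ = ∑-cartesianProductWith _,_ (allFin _) (allFin _)

  ∑²-* : ∀ (f g : Fin n → ℕ) → ∑² n (λ (i , j) → f i * g j) ≡ ∑ (allFin n) f * ∑ (allFin n) g
  ∑²-* {n} f g = trans (∑²-∑∑ {n} λ (i , j) → f i * g j) (∑-*-∑ (allFin _) (allFin _) f g)

  -- Double counting. For each fixed `t` the switching `φ t` permutes the graphs, so the weight of
  -- `G` may be compared with that of its image and the image renamed; bijectivity enters as the
  -- reindexing hypothesis.
  ∑-transfer : ∀ (ts : List T) (φ : T → Graph n → Graph n) →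
    (∀ t (w : Graph n → ℕ) → ∑[ G ∈ graphs n ] w (φ t G) ≡ ∑ (graphs n) w) →
    (w w′ : Graph n → T → ℕ) → (∀ t G → w G t ≤ w′ (φ t G) t) →
    ∑[ G ∈ graphs n ] ∑ ts (w G) ≤ ∑[ G ∈ graphs n ] ∑ ts (w′ G)
  ∑-transfer {n = n} ts φ reindex w w′ w≤w′ = begin
    ∑[ G ∈ graphs n ] ∑ ts (w G)                       ≡⟨ ∑-swap (graphs n) ts w ⟩
    ∑[ t ∈ ts ] ∑[ G ∈ graphs n ] w G t
      ≤⟨ ∑-mono ts (λ t → ∑-mono (graphs n) (w≤w′ t)) ⟩
    ∑[ t ∈ ts ] ∑[ G ∈ graphs n ] w′ (φ t G) t
      ≡⟨ ∑-cong ts (λ t → reindex t (λ G → w′ G t)) ⟩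
    ∑[ t ∈ ts ] ∑[ G ∈ graphs n ] w′ G t               ≡⟨ ∑-swap (graphs n) ts w′ ⟨
    ∑[ G ∈ graphs n ] ∑ ts (w′ G)                      ∎
    where open ≤-Reasoning

  module Counting {n} (d : Vec ℕ n) (H₁ H₂ : Graph n) where

    open Switching d H₁ H₂

    -- The truncated subtractions in m and r are exact since degrees H₁ ≼ d.
    Δ m : ℕ
    Δ = maximum d
    m = Vec.sum d ∸ 2 * edges H₁

    r : Fin n → ℕ
    r i = lookup d i ∸ deg H₁ i

    -- A bound on the number of oriented loose edges that are not switchable for two vertices of
    -- degrees `h` and `h′` in `H₂`.
    K : ℕ → ℕ → ℕ
    K h h′ = 2 * J d + 2 * Δ + (h + h′) * Δ

    module _ {G : Graph n} (adm : Admissible G) where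

      deg-G : ∀ i → deg G i ≡ lookup d i
      deg-G i = trans (sym (Vec.lookup∘tabulate (deg G) i)) (cong (λ c → lookup c i) (proj₁ adm))

      deg-G≤Δ : ∀ i → deg G i ≤ Δ
      deg-G≤Δ i = ≤-trans (≤-reflexive (deg-G i)) (lookup≤maximum d i)

      -- As `G` contains `H₁`, the neighbours of `i` in `G` split into those in `H₁` and the loose
      -- ones.
      ∑-loose+deg : ∀ i → deg H₁ i + ∑[ j ∈ allFin n ] 𝟙 (loose? G i j) ≡ lookup d i
      ∑-loose+deg i = begin
        deg H₁ i + ∑[ j ∈ allFin n ] 𝟙 (loose? G i j)
          ≡⟨ cong (_+ ∑[ j ∈ allFin n ] 𝟙 (loose? G i j)) (deg-∑ H₁ i) ⟨
        ∑[ j ∈ allFin n ] 𝟙 (Adj? i j H₁) + ∑[ j ∈ allFin n ] 𝟙 (loose? G i j)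
          ≡⟨ ∑-+ (allFin n) _ _ ⟨
        ∑[ j ∈ allFin n ] (𝟙 (Adj? i j H₁) + 𝟙 (loose? G i j))
          ≡⟨ ∑-cong (allFin n) split ⟨
        ∑[ j ∈ allFin n ] 𝟙 (Adj? i j G)  ≡⟨ deg-∑ G i ⟩
        deg G i                           ≡⟨ deg-G i ⟩
        lookup d i                        ∎
        where
        open ≡-Reasoning
        split : ∀ j → 𝟙 (Adj? i j G) ≡ 𝟙 (Adj? i j H₁) + 𝟙 (loose? G i j)
        split j = trans (𝟙-split (Adj? i j G) (Adj? i j H₁)) (cong (_+ 𝟙 (loose? G i j))
          (𝟙-cong (Adj? i j G ×-dec Adj? i j H₁) (Adj? i j H₁) proj₂
             (λ ij → proj₁ (proj₂ adm) i ij , ij)))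

      ∑-loose : ∀ i → ∑[ j ∈ allFin n ] 𝟙 (loose? G i j) ≡ r i
      ∑-loose i = trans (sym (m+n∸m≡n (deg H₁ i) _)) (cong (_∸ deg H₁ i) (∑-loose+deg i))

      -- Each loose edge counts once per orientation, which explains the term 2e(H₁).
      ∑∑-loose : ∑[ i ∈ allFin n ] ∑[ j ∈ allFin n ] 𝟙 (loose? G i j) ≡ m
      ∑∑-loose = trans (sym (m+n∸m≡n (2 * edges H₁) _)) (cong (_∸ 2 * edges H₁) (begin
        2 * edges H₁ + L                                       ≡⟨ cong (_+ L) (∑-deg H₁) ⟨
        ∑ (allFin n) (deg H₁) + L                              ≡⟨ ∑-+ (allFin n) _ _ ⟨
        ∑[ i ∈ allFin n ] (deg H₁ i + ∑[ j ∈ allFin n ] 𝟙 (loose? G i j))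
                                                               ≡⟨ ∑-cong (allFin n) ∑-loose+deg ⟩
        ∑[ i ∈ allFin n ] lookup d i                           ≡⟨ ∑-lookup≡sum d ⟩
        Vec.sum d                                              ∎))
        where
        open ≡-Reasoning
        L = ∑[ i ∈ allFin n ] ∑[ j ∈ allFin n ] 𝟙 (loose? G i j)

      -- The reasons why `pa` may fail to be free, counted with multiplicity.
      obstruction : Fin n → Fin n → ℕ
      obstruction p a = δ p a + (𝟙 (Adj? p a G) + 𝟙 (Adj? p a H₂))

      ¬free⇒obstruction : ∀ p a → ¬ Free G p a → 1 ≤ obstruction p a
      ¬free⇒obstruction p a ¬free with p ≟ a | Adj? p a G | Adj? p a H₂
      ... | yes _  | _       | _       = s≤s z≤n
      ... | no _   | yes _   | _       = s≤s z≤n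
      ... | no _   | no _    | yes _   = s≤s z≤n
      ... | no p≢a | no ¬pa  | no ¬pa′ = ⊥-elim (¬free (p≢a , ¬pa , ¬pa′))

      -- Weighting `a` by its degree counts oriented edges that start at `a`. The case `a = p` costs
      -- at most Δ, the neighbours of `p` in `G` at most `J d`, and those in `H₂` at most Δ each.
      ∑-obstruction : ∀ p → ∑[ a ∈ allFin n ] (obstruction p a * deg G a) ≤ Δ + (J d + deg H₂ p * Δ)
      ∑-obstruction p = begin
        ∑[ a ∈ allFin n ] (obstruction p a * deg G a)
          ≡⟨ ∑-cong (allFin n) (λ a → expand (δ p a) (𝟙 (Adj? p a G)) (𝟙 (Adj? p a H₂)) (deg G a)) ⟩
        ∑[ a ∈ allFin n ] (δ p a * deg G a + (𝟙 (Adj? p a G) * deg G a + 𝟙 (Adj? p a H₂) * deg G a))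
          ≡⟨ trans (∑-+ (allFin n) _ _) (cong (∑[ a ∈ allFin n ] (δ p a * deg G a) +_) (∑-+ (allFin n) _ _)) ⟩
        ∑[ a ∈ allFin n ] (δ p a * deg G a) +
          (∑[ a ∈ allFin n ] (𝟙 (Adj? p a G) * deg G a) + ∑[ a ∈ allFin n ] (𝟙 (Adj? p a H₂) * deg G a))
          ≤⟨ +-mono-≤ (≤Δ (δ p)) (+-mono-≤ ≤J (≤Δ λ a → 𝟙 (Adj? p a H₂))) ⟩
        ∑ (allFin n) (δ p) * Δ + (J d + ∑[ a ∈ allFin n ] 𝟙 (Adj? p a H₂) * Δ)
          ≡⟨ cong₂ (λ x y → x * Δ + (J d + y * Δ)) (∑-𝟙-≟ p) (deg-∑ H₂ p) ⟩
        1 * Δ + (J d + deg H₂ p * Δ)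
          ≡⟨ cong (_+ (J d + deg H₂ p * Δ)) (*-identityˡ Δ) ⟩
        Δ + (J d + deg H₂ p * Δ)  ∎
        where
        open ≤-Reasoning
        expand : ∀ x y z g → (x + (y + z)) * g ≡ x * g + (y * g + z * g)
        expand = solve-∀
        ≤Δ : ∀ c → ∑[ a ∈ allFin n ] (c a * deg G a) ≤ ∑ (allFin n) c * Δ
        ≤Δ c = ≤-trans (∑-mono (allFin n) λ a → *-monoʳ-≤ (c a) (deg-G≤Δ a))
                       (≤-reflexive (∑-*ʳ (allFin n) c Δ))
        𝟙≤1 : ∀ {P : Set} (P? : Dec P) → 𝟙 P? ≤ 1
        𝟙≤1 (yes _) = ≤-refl
        𝟙≤1 (no _)  = z≤n
        -- The vertex `p` has at most Δ neighbours, so `J` bounds the sum of their degrees.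
        ≤J : ∑[ a ∈ allFin n ] (𝟙 (Adj? p a G) * deg G a) ≤ J d
        ≤J = ≤-trans
          (≤-reflexive (∑-cong (allFin n) λ a → cong (𝟙 (Adj? p a G) *_) (deg-G a)))
          (weight≤1⇒∑≤J d (λ a → 𝟙 (Adj? p a G)) (λ a → 𝟙≤1 (Adj? p a G))
            (≤-trans (≤-reflexive (deg-∑ G p)) (deg-G≤Δ p)))

      -- A loose `ab` that is not switchable has `pa` or `qb` obstructed. Summing out the other end
      -- of the edge leaves the two sums bounded by `∑-obstruction`.
      m≤∑-switchable+K : ∀ p q →
        m ≤ ∑² n (λ (a , b) → 𝟙 (switchable? G p q a b)) + K (deg H₂ p) (deg H₂ q)
      m≤∑-switchable+K p q = begin
        m                                                                 ≡⟨ ∑∑-loose ⟨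
        ∑[ a ∈ V ] ∑[ b ∈ V ] 𝟙 (loose? G a b)
          ≤⟨ ∑-mono V (λ a → ∑-mono V (pointwise a)) ⟩
        ∑[ a ∈ V ] ∑[ b ∈ V ] (sw a b + (A a b + B a b))
          ≡⟨ ∑∑-+ sw (λ a b → A a b + B a b) ⟩
        ∑∑ sw + ∑∑ (λ a b → A a b + B a b)
          ≡⟨ cong (∑∑ sw +_) (∑∑-+ A B) ⟩
        ∑∑ sw + (∑∑ A + ∑∑ B)
          ≡⟨ cong (λ x → ∑∑ sw + (∑∑ A + x)) (∑-swap V V B) ⟩
        ∑∑ sw + (∑∑ A + ∑∑ (λ b a → B a b))
          ≤⟨ +-monoʳ-≤ (∑∑ sw) (+-mono-≤ (factor p) (factor q)) ⟩
        ∑∑ sw + ((Δ + (J d + deg H₂ p * Δ)) + (Δ + (J d + deg H₂ q * Δ)))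
          ≡⟨ cong₂ _+_ (sym (∑²-∑∑ (uncurry sw))) (collect (J d) Δ (deg H₂ p) (deg H₂ q)) ⟩
        ∑² n (uncurry sw) + K (deg H₂ p) (deg H₂ q)                       ∎
        where
        open ≤-Reasoning
        V = allFin n
        ∑∑ : (Fin n → Fin n → ℕ) → ℕ
        ∑∑ f = ∑[ a ∈ V ] ∑[ b ∈ V ] f a b
        ∑∑-+ : ∀ f g → ∑∑ (λ a b → f a b + g a b) ≡ ∑∑ f + ∑∑ g
        ∑∑-+ f g = trans (∑-cong V λ a → ∑-+ V (f a) (g a)) (∑-+ V _ _)
        sw A B : Fin n → Fin n → ℕ
        sw a b = 𝟙 (switchable? G p q a b)
        A a b = obstruction p a * 𝟙 (Adj? a b G)
        -- The edge is read as `ba`, so that after exchanging the sums `factor` applies to `q`.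
        B a b = obstruction q b * 𝟙 (Adj? b a G)
        collect : ∀ j e x y → (e + (j + x * e)) + (e + (j + y * e)) ≡ 2 * j + 2 * e + (x + y) * e
        collect = solve-∀
        factor : ∀ p → ∑[ a ∈ V ] ∑[ b ∈ V ] (obstruction p a * 𝟙 (Adj? a b G)) ≤ Δ + (J d + deg H₂ p * Δ)
        factor p = ≤-trans
          (≤-reflexive (∑-cong V λ a → trans (∑-*ˡ V (obstruction p a) _) (cong (obstruction p a *_) (deg-∑ G a))))
          (∑-obstruction p)
        pointwise : ∀ a b → 𝟙 (loose? G a b) ≤ sw a b + (A a b + B a b)
        pointwise a b = 𝟙≤𝟙-×+ (loose? G a b) (free? G p a) (free? G q b)
          (λ (ab , _) ¬free → *-mono-≤ (¬free⇒obstruction p a ¬free) (𝟙-yes (Adj? a b G) ab))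
          (λ (ab , _) ¬free → *-mono-≤ (¬free⇒obstruction q b ¬free) (𝟙-yes (Adj? b a G) (Adj-sym G ab)))

    module _ (u v : Fin n) where

      with-uv? : ∀ G → Dec (Admissible G × Adj G u v)
      with-uv? G = admissible? G ×-dec Adj? u v G

      without-uv? : ∀ G → Dec (Admissible G × ¬ Adj G u v)
      without-uv? G = admissible? G ×-dec ¬? (Adj? u v G)

      #with #without : ℕ
      #with    = ∑[ G ∈ graphs n ] 𝟙 (with-uv? G)
      #without = ∑[ G ∈ graphs n ] 𝟙 (without-uv? G)

    module _ (u v : Fin n) (u≢v : u ≢ v) (∉H₁ : ¬ Adj H₁ u v) (∉H₂ : ¬ Adj H₂ u v) where

      private
        A C : ℕ
        A = #with u v
        C = #without u v
        with?    = with-uv? u v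
        without? = without-uv? u v

      -- This is A(m - K) ≤ C r_u r_v with the subtracted term moved across. `forward` counts
      -- switchings out of the graphs with `uv`, `backward` the possible origins of a graph without
      -- it.
      #with-upper : A * m ≤ C * (r u * r v) + A * K (deg H₂ u) (deg H₂ v)
      #with-upper = begin
        A * m                                                     ≡⟨ ∑-*ʳ (graphs n) _ m ⟨
        ∑[ G ∈ graphs n ] (𝟙 (with? G) * m)                        ≤⟨ ∑-mono (graphs n) forward ⟩
        ∑[ G ∈ graphs n ] (∑² n (w G) + 𝟙 (with? G) * k)           ≡⟨ ∑-+ (graphs n) _ _ ⟩
        ∑[ G ∈ graphs n ] ∑² n (w G) + ∑[ G ∈ graphs n ] (𝟙 (with? G) * k)
          ≤⟨ +-mono-≤ (∑-transfer (pairs n) φ reindex w w′ switched)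
                      (≤-reflexive (∑-*ʳ (graphs n) _ k)) ⟩
        ∑[ G ∈ graphs n ] ∑² n (w′ G) + A * k
          ≡⟨ cong (_+ A * k) (∑-cong (graphs n) backward) ⟩
        ∑[ G ∈ graphs n ] (𝟙 (without? G) * (r u * r v)) + A * k
          ≡⟨ cong (_+ A * k) (∑-*ʳ (graphs n) _ (r u * r v)) ⟩
        C * (r u * r v) + A * k                            ∎
        where
        open ≤-Reasoning
        k = K (deg H₂ u) (deg H₂ v)
        φ : Fin n × Fin n → Graph n → Graph n
        φ (x , y) = switch₂ u v x y
        sw l : Graph n → Fin n × Fin n → ℕ
        sw G (x , y) = 𝟙 (switchable? G u v x y)
        l  G (x , y) = 𝟙 (loose? G u x) * 𝟙 (loose? G v y)
        w w′ : Graph n → Fin n × Fin n → ℕ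
        w  G t = 𝟙 (with? G) * sw G t
        w′ G t = 𝟙 (without? G) * l G t
        reindex : ∀ t (w : Graph n → ℕ) → ∑[ G ∈ graphs n ] w (φ t G) ≡ ∑ (graphs n) w
        reindex (x , y) w =
          trans (∑-graphs-toggle u v (w ∘ toggle v y ∘ toggle u x ∘ toggle x y))
          (trans (∑-graphs-toggle x y (w ∘ toggle v y ∘ toggle u x))
          (trans (∑-graphs-toggle u x (w ∘ toggle v y)) (∑-graphs-toggle v y w)))
        forward : ∀ G → 𝟙 (with? G) * m ≤ ∑² n (w G) + 𝟙 (with? G) * k
        forward G = begin
          𝟙 (with? G) * m
            ≤⟨ 𝟙*-mono (with? G) (λ (adm , _) → m≤∑-switchable+K adm u v) ⟩
          𝟙 (with? G) * (∑² n (sw G) + k)       ≡⟨ *-distribˡ-+ (𝟙 (with? G)) _ k ⟩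
          𝟙 (with? G) * ∑² n (sw G) + 𝟙 (with? G) * k
            ≡⟨ cong (_+ 𝟙 (with? G) * k) (∑-*ˡ (pairs n) (𝟙 (with? G)) (sw G)) ⟨
          ∑² n (w G) + 𝟙 (with? G) * k          ∎
        switched : ∀ t G → w G t ≤ w′ (φ t G) t
        switched t@(x , y) G = 𝟙-×-mono (with? G) (switchable? G u v x y)
          (without? (φ t G)) (loose? (φ t G) u x) (loose? (φ t G) v y)
          (switch₂-correct u v ∉H₁ ∉H₂ x y)
        backward : ∀ G → ∑² n (w′ G) ≡ 𝟙 (without? G) * (r u * r v)
        backward G = trans (∑-*ˡ (pairs n) (𝟙 (without? G)) (l G))
          (𝟙*-cong (without? G) λ (adm , _) →
            trans (∑²-* (λ x → 𝟙 (loose? G u x)) (λ y → 𝟙 (loose? G v y)))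
                  (cong₂ _*_ (∑-loose adm u) (∑-loose adm v)))

      -- This is C r_u r_v (m - K) ≤ A m² in additive form. The vertices `x` and `y` vary, so their
      -- degrees in `H₂` are replaced by a uniform bound `h`.
      #with-lower : ∀ h → (∀ i → deg H₂ i ≤ h) →
                    C * (r u * r v) * m ≤ A * (m * m) + C * (r u * r v) * K h h
      #with-lower h deg≤h = begin
        C * R * m                                              ≡⟨ *-assoc C R m ⟩
        C * (R * m)                                            ≡⟨ ∑-*ʳ (graphs n) _ (R * m) ⟨
        ∑[ G ∈ graphs n ] (𝟙 (without? G) * (R * m))               ≤⟨ ∑-mono (graphs n) forward ⟩
        ∑[ G ∈ graphs n ] (∑ V⁴ (w G) + 𝟙 (without? G) * (R * k))  ≡⟨ ∑-+ (graphs n) _ _ ⟩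
        ∑[ G ∈ graphs n ] ∑ V⁴ (w G) + ∑[ G ∈ graphs n ] (𝟙 (without? G) * (R * k))
          ≤⟨ +-mono-≤ (∑-transfer V⁴ φ reindex w w′ switched)
                      (≤-reflexive (trans (∑-*ʳ (graphs n) _ (R * k)) (sym (*-assoc C R k)))) ⟩
        ∑[ G ∈ graphs n ] ∑ V⁴ (w′ G) + C * R * k
          ≡⟨ cong (_+ C * R * k) (∑-cong (graphs n) backward) ⟩
        ∑[ G ∈ graphs n ] (𝟙 (with? G) * (m * m)) + C * R * k
          ≡⟨ cong (_+ C * R * k) (∑-*ʳ (graphs n) _ (m * m)) ⟩
        A * (m * m) + C * R * k                            ∎
        where
        open ≤-Reasoning
        R = r u * r v
        k = K h h
        V² = pairs n
        V⁴ = cartesianProduct V² V²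
        φ : (Fin n × Fin n) × (Fin n × Fin n) → Graph n → Graph n
        φ ((x , y) , (a , b)) = switch₃ u v x y a b
        l : Graph n → Fin n × Fin n → ℕ
        l G (x , y) = 𝟙 (loose? G u x) * 𝟙 (loose? G v y)
        sw : Graph n → Fin n × Fin n → Fin n × Fin n → ℕ
        sw G (x , y) (a , b) = 𝟙 (switchable? G x y a b)
        l′ : Graph n → (Fin n × Fin n) × (Fin n × Fin n) → ℕ
        l′ G ((x , y) , (a , b)) = 𝟙 (loose? G x a) * 𝟙 (loose? G y b)
        w w′ : Graph n → (Fin n × Fin n) × (Fin n × Fin n) → ℕ
        w  G (s , t) = 𝟙 (without? G) * (l G s * sw G s t)
        w′ G t = 𝟙 (with? G) * l′ G t
        reindex : ∀ t (w : Graph n → ℕ) → ∑[ G ∈ graphs n ] w (φ t G) ≡ ∑ (graphs n) w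
        reindex ((x , y) , (a , b)) w =
          trans (∑-graphs-toggle u x (w ∘ toggle y b ∘ toggle x a ∘ toggle u v ∘ toggle a b ∘ toggle v y))
          (trans (∑-graphs-toggle v y (w ∘ toggle y b ∘ toggle x a ∘ toggle u v ∘ toggle a b))
          (trans (∑-graphs-toggle a b (w ∘ toggle y b ∘ toggle x a ∘ toggle u v))
          (trans (∑-graphs-toggle u v (w ∘ toggle y b ∘ toggle x a))
          (trans (∑-graphs-toggle x a (w ∘ toggle y b)) (∑-graphs-toggle y b w)))))
        K≤k : ∀ x y → K (deg H₂ x) (deg H₂ y) ≤ k
        K≤k x y = +-monoʳ-≤ (2 * J d + 2 * Δ) (*-monoˡ-≤ Δ (+-mono-≤ (deg≤h x) (deg≤h y)))
        module _ {G : Graph n} (adm : Admissible G) where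
          ∑-l : ∑² n (l G) ≡ R
          ∑-l = trans (∑²-* (λ x → 𝟙 (loose? G u x)) (λ y → 𝟙 (loose? G v y)))
                      (cong₂ _*_ (∑-loose adm u) (∑-loose adm v))
          ∑-l-sw : R * m ≤ ∑² n (λ s → ∑² n (λ t → l G s * sw G s t)) + R * k
          ∑-l-sw = begin
            R * m                                                ≡⟨ cong (_* m) ∑-l ⟨
            ∑² n (l G) * m                                       ≡⟨ ∑-*ʳ V² (l G) m ⟨
            ∑² n (λ s → l G s * m)
              ≤⟨ ∑-mono V² (λ s@(x , y) → *-monoʳ-≤ (l G s)
                   (≤-trans (m≤∑-switchable+K adm x y) (+-monoʳ-≤ (∑² n (sw G s)) (K≤k x y)))) ⟩
            ∑² n (λ s → l G s * (∑² n (sw G s) + k))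
              ≡⟨ ∑-cong V² (λ s → *-distribˡ-+ (l G s) _ k) ⟩
            ∑² n (λ s → l G s * ∑² n (sw G s) + l G s * k)       ≡⟨ ∑-+ V² _ _ ⟩
            ∑² n (λ s → l G s * ∑² n (sw G s)) + ∑² n (λ s → l G s * k)
              ≡⟨ cong₂ _+_ (∑-cong V² λ s → sym (∑-*ˡ V² (l G s) (sw G s)))
                           (trans (∑-*ʳ V² (l G) k) (cong (_* k) ∑-l)) ⟩
            ∑² n (λ s → ∑² n (λ t → l G s * sw G s t)) + R * k   ∎
          ∑-l′ : ∑ V⁴ (l′ G) ≡ m * m
          ∑-l′ = begin-equality
            ∑ V⁴ (l′ G)
              ≡⟨ ∑-cartesianProductWith _,_ V² V² (l′ G) ⟩
            ∑² n (λ s → ∑² n (λ t → l′ G (s , t)))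
              -- The quadruple is stored as `(x , y)`, `(a , b)` but factors as `xa`, `yb`, two
              -- independent oriented loose edges.
              ≡⟨ ∑-cong V² (λ (x , y) → ∑²-* (λ a → 𝟙 (loose? G x a)) (λ b → 𝟙 (loose? G y b))) ⟩
            ∑² n (λ (x , y) → L x * L y)                  ≡⟨ ∑²-* L L ⟩
            ∑ (allFin n) L * ∑ (allFin n) L
              ≡⟨ cong₂ _*_ (∑∑-loose adm) (∑∑-loose adm) ⟩
            m * m                                         ∎
            where
            L : Fin n → ℕ
            L x = ∑[ a ∈ allFin n ] 𝟙 (loose? G x a)
        forward : ∀ G → 𝟙 (without? G) * (R * m) ≤ ∑ V⁴ (w G) + 𝟙 (without? G) * (R * k)
        forward G = begin
          𝟙 (without? G) * (R * m)
            ≤⟨ 𝟙*-mono (without? G) (λ (adm , _) → ∑-l-sw adm) ⟩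
          𝟙 (without? G) * (Q + R * k)             ≡⟨ *-distribˡ-+ (𝟙 (without? G)) Q (R * k) ⟩
          𝟙 (without? G) * Q + 𝟙 (without? G) * (R * k)
            ≡⟨ cong (_+ 𝟙 (without? G) * (R * k)) (begin-equality
                 𝟙 (without? G) * Q                ≡⟨ cong (𝟙 (without? G) *_) (∑-cartesianProductWith _,_ V² V² q) ⟨
                 𝟙 (without? G) * ∑ V⁴ q           ≡⟨ ∑-*ˡ V⁴ (𝟙 (without? G)) q ⟨
                 ∑ V⁴ (w G)                           ∎) ⟩
          ∑ V⁴ (w G) + 𝟙 (without? G) * (R * k)    ∎
          where
          q : (Fin n × Fin n) × (Fin n × Fin n) → ℕ
          q (s , t) = l G s * sw G s t
          Q = ∑² n (λ s → ∑² n (λ t → q (s , t)))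
        switched : ∀ t G → w G t ≤ w′ (φ t G) t
        switched t@((x , y) , (a , b)) G = begin
          𝟙 (without? G) * (l G (x , y) * sw G (x , y) (a , b))
            ≡⟨ cong (λ z → 𝟙 (without? G) * (z * sw G (x , y) (a , b))) (𝟙-× (loose? G u x) (loose? G v y)) ⟨
          𝟙 (without? G) * (𝟙 (loose? G u x ×-dec loose? G v y) * 𝟙 (switchable? G x y a b))
            ≡⟨ cong (𝟙 (without? G) *_) (𝟙-× (loose? G u x ×-dec loose? G v y) (switchable? G x y a b)) ⟨
          𝟙 (without? G) * 𝟙 ((loose? G u x ×-dec loose? G v y) ×-dec switchable? G x y a b)
            ≤⟨ 𝟙-×-mono (without? G) ((loose? G u x ×-dec loose? G v y) ×-dec switchable? G x y a b)
                 (with? (φ t G)) (loose? (φ t G) x a) (loose? (φ t G) y b)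
                 (λ adm (xy , s) → switch₃-correct u v ∉H₁ ∉H₂ u≢v x y a b adm xy s) ⟩
          w′ (φ t G) t  ∎
        backward : ∀ G → ∑ V⁴ (w′ G) ≡ 𝟙 (with? G) * (m * m)
        backward G = trans (∑-*ˡ V⁴ (𝟙 (with? G)) (l′ G))
          (𝟙*-cong (with? G) λ (adm , _) → ∑-l′ adm)

-- Passage from natural numbers to rationals.

open import Data.Integer using (+_)
open import Data.Rational
  using (ℚ; mkℚ; 0ℚ; 1ℚ; NonZero; Positive; _+_; _-_; -_; _*_; _/_; _÷_; 1/_;
         _≤_; _<_; positive; nonNegative)
open import Data.Rational.Properties

-- `_/_` normalises by a gcd that is stuck on a variable. The explicit form exposes numerator and
-- denominator, after which sums and products compute up to factors 1.
ι≡mkℚ : ∀ k → ι k ≡ mkℚ (+ k) 0 (Coprimality.sym (1-coprimeTo k))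
ι≡mkℚ k = ↥p/↧p≡p (mkℚ (+ k) 0 (Coprimality.sym (1-coprimeTo k)))

ι-+ : ∀ m n → ι (m ℕ.+ n) ≡ ι m + ι n
ι-+ m n rewrite ι≡mkℚ m | ι≡mkℚ n =
  cong (_/ 1) (sym (cong₂ ℤ._+_ (ℤ.*-identityʳ (+ m)) (ℤ.*-identityʳ (+ n))))

ι-* : ∀ m n → ι (m ℕ.* n) ≡ ι m * ι n
ι-* m n rewrite ι≡mkℚ m | ι≡mkℚ n = cong (_/ 1) (ℤ.pos-* m n)

ι-∸ : ∀ {m n} → n ℕ.≤ m → ι (m ℕ.∸ n) ≡ ι m - ι n
ι-∸ {m} {n} n≤m = begin
  ι (m ℕ.∸ n)                     ≡⟨ +-identityʳ _ ⟨
  ι (m ℕ.∸ n) + 0ℚ                ≡⟨ cong (λ x → ι (m ℕ.∸ n) + x) (+-inverseʳ (ι n)) ⟨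
  ι (m ℕ.∸ n) + (ι n - ι n)       ≡⟨ +-assoc (ι (m ℕ.∸ n)) (ι n) (- ι n) ⟨
  (ι (m ℕ.∸ n) + ι n) - ι n       ≡⟨ cong (_- ι n) (ι-+ (m ℕ.∸ n) n) ⟨
  ι (m ℕ.∸ n ℕ.+ n) - ι n         ≡⟨ cong (λ k → ι k - ι n) (ℕ.m∸n+n≡m n≤m) ⟩
  ι m - ι n                       ∎
  where open ≡-Reasoning

0≤ι : ∀ n → 0ℚ ≤ ι n
0≤ι n = ι-mono-≤ {0} {n} ℕ.z≤n

0≤* : ∀ {p q} → 0ℚ ≤ p → 0ℚ ≤ q → 0ℚ ≤ p * q
0≤* {p} {q} 0≤p 0≤q = nonNegative⁻¹ (p * q)
  {{nonNeg*nonNeg⇒nonNeg p {{nonNegative 0≤p}} q {{nonNegative 0≤q}}}}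

p-q≤p : ∀ p {q} → 0ℚ ≤ q → p - q ≤ p
p-q≤p p 0≤q = ≤-trans (+-monoʳ-≤ p (neg-antimono-≤ 0≤q)) (≤-reflexive (+-identityʳ p))

/-*-cancel : ∀ a N .{{_ : ℕ.NonZero N}} → (+ a / N) * ι N ≡ ι a
-- In the unnormalised rationals equality is cross-multiplication and no gcd intervenes.
/-*-cancel a (suc k) = toℚᵘ-injective (ℚᵘ.≃-trans (toℚᵘ-homo-* (+ a / suc k) (ι (suc k)))
  (ℚᵘ.≃-trans (ℚᵘ.*-cong (toℚᵘ-fromℚᵘ (mkℚᵘ (+ a) k)) (toℚᵘ-fromℚᵘ (mkℚᵘ (+ suc k) 0)))
  (ℚᵘ.≃-trans (*≡* (trans (ℤ.*-identityʳ (+ a ℤ.* + suc k))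
                          (cong (λ x → + a ℤ.* x) (sym (ℤ.*-identityʳ (+ suc k))))))
              (ℚᵘ.≃-sym (toℚᵘ-fromℚᵘ (mkℚᵘ (+ a) 0))))))

÷-*-cancel : ∀ p q .{{_ : NonZero q}} → (p ÷ q) * q ≡ p
÷-*-cancel p q = trans (*-assoc p (1/ q) q)
  (trans (cong (λ x → p * x) (*-inverseˡ q)) (*-identityʳ p))

-- i stands for 1/M, so that ratio = R i, and j for the inverse of the
-- denominator of f or g.
module Bounds (A C R M i P : ℚ) (iM≡1 : i * M ≡ 1ℚ) (0<M : 0ℚ < M)
              (0≤A : 0ℚ ≤ A) (0≤R : 0ℚ ≤ R)
              (0<B : 0ℚ < A + C) (PB≡A : P * (A + C) ≡ A) where

  open +-*-Solver
  open ≤-Reasoning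

  private
    B = A + C

    0≤i : 0ℚ ≤ i
    0≤i = *-cancelʳ-≤-pos M {{positive 0<M}} (begin
      0ℚ * M   ≡⟨ *-zeroˡ M ⟩
      0ℚ       ≤⟨ 0≤ι 1 ⟩
      1ℚ       ≡⟨ iM≡1 ⟨
      i * M    ∎)

  -- Multiplying by the positive `B * (D * M)` clears all denominators. The hypothesis then bounds
  -- the left side by `R * B - A * (Y * i)`, from which a nonnegative term is dropped.
  upper : ∀ X Y (let D = 1ℚ - X * i - Y * i * i + R * i) j → 0ℚ ≤ Y → 0ℚ < D → j * D ≡ 1ℚ →
          A * M ≤ C * R + A * X → P ≤ R * i * j
  upper X Y j 0≤Y 0<D jD≡1 hyp = *-cancelʳ-≤-pos (B * (D * M)) {{scale-pos}} (begin
    P * (B * (D * M))                               ≡⟨ *-assoc P B (D * M) ⟨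
    P * B * (D * M)                                 ≡⟨ cong₂ _*_ PB≡A DM≡ ⟩
    A * (M - X - Y * i + R)
      ≡⟨ solve 6 (λ A M X Y i R →
           A :* (M :- X :- Y :* i :+ R) :=
           A :* M :+ (A :* R :- A :* X :- A :* (Y :* i))) refl A M X Y i R ⟩
    A * M + (A * R - A * X - A * (Y * i))           ≤⟨ +-monoˡ-≤ _ hyp ⟩
    (C * R + A * X) + (A * R - A * X - A * (Y * i))
      ≡⟨ solve 6 (λ A C X Y i R →
           (C :* R :+ A :* X) :+ (A :* R :- A :* X :- A :* (Y :* i)) :=
           R :* (A :+ C) :- A :* (Y :* i)) refl A C X Y i R ⟩
    R * B - A * (Y * i)                             ≤⟨ p-q≤p (R * B) (0≤* 0≤A (0≤* 0≤Y 0≤i)) ⟩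
    R * B                                           ≡⟨ *-identityʳ (R * B) ⟨
    R * B * 1ℚ                                      ≡⟨ cong (λ x → R * B * x) (cong₂ _*_ iM≡1 jD≡1) ⟨
    R * B * ((i * M) * (j * D))
      ≡⟨ solve 6 (λ R B i M j D →
           R :* B :* ((i :* M) :* (j :* D)) :=
           R :* i :* j :* (B :* (D :* M))) refl R B i M j D ⟩
    R * i * j * (B * (D * M))                       ∎)
    where
    D = 1ℚ - X * i - Y * i * i + R * i
    scale-pos = pos*pos⇒pos B {{positive 0<B}} (D * M) {{pos*pos⇒pos D {{positive 0<D}} M {{positive 0<M}}}}
    DM≡ : D * M ≡ M - X - Y * i + R
    DM≡ = begin-equality
      D * M
        ≡⟨ solve 5 (λ X Y i R M →
             (con 1ℚ :- X :* i :- Y :* i :* i :+ R :* i) :* M :=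
             M :- X :* (i :* M) :- Y :* i :* (i :* M) :+ R :* (i :* M)) refl X Y i R M ⟩
      M - X * (i * M) - Y * i * (i * M) + R * (i * M)
        ≡⟨ cong (λ t → M - X * t - Y * i * t + R * t) iM≡1 ⟩
      M - X * 1ℚ - Y * i * 1ℚ + R * 1ℚ
        ≡⟨ solve 5 (λ X Y i R M →
             M :- X :* con 1ℚ :- Y :* i :* con 1ℚ :+ R :* con 1ℚ :=
             M :- X :- Y :* i :+ R) refl X Y i R M ⟩
      M - X - Y * i + R                                        ∎

  -- The same method with the factor `B * (E * (M * M))`; the nonnegative term dropped is
  -- `A * (R * Z)`.
  lower : ∀ Z j → 0ℚ ≤ Z → 0ℚ < 1ℚ + R * i → j * (1ℚ + R * i) ≡ 1ℚ →
          C * R * M ≤ A * (M * M) + C * R * Z → R * i * ((1ℚ - Z * i) * j) ≤ P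
  lower Z j 0≤Z 0<E jE≡1 hyp = *-cancelʳ-≤-pos (B * (E * (M * M))) {{scale-pos}} (begin
    R * i * ((1ℚ - Z * i) * j) * (B * (E * (M * M)))
      ≡⟨ solve 7 (λ R i Z j B E M →
           R :* i :* ((con 1ℚ :- Z :* i) :* j) :* (B :* (E :* (M :* M))) :=
           R :* (i :* M) :* (M :- Z :* (i :* M)) :* (j :* E) :* B) refl R i Z j B E M ⟩
    R * (i * M) * (M - Z * (i * M)) * (j * E) * B
      ≡⟨ cong₂ (λ t s → R * t * (M - Z * t) * s * B) iM≡1 jE≡1 ⟩
    R * 1ℚ * (M - Z * 1ℚ) * 1ℚ * B
      ≡⟨ solve 5 (λ R M Z A C →
           R :* con 1ℚ :* (M :- Z :* con 1ℚ) :* con 1ℚ :* (A :+ C) :=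
           C :* R :* M :+ (A :* R :* M :- C :* R :* Z :- A :* (R :* Z))) refl R M Z A C ⟩
    C * R * M + (A * R * M - C * R * Z - A * (R * Z)) ≤⟨ +-monoˡ-≤ _ hyp ⟩
    (A * (M * M) + C * R * Z) + (A * R * M - C * R * Z - A * (R * Z))
      ≡⟨ solve 5 (λ R M Z A C →
           (A :* (M :* M) :+ C :* R :* Z) :+ (A :* R :* M :- C :* R :* Z :- A :* (R :* Z)) :=
           (A :* (M :* M) :+ A :* R :* con 1ℚ :* M) :- A :* (R :* Z)) refl R M Z A C ⟩
    (A * (M * M) + A * R * 1ℚ * M) - A * (R * Z)      ≤⟨ p-q≤p _ (0≤* 0≤A (0≤* 0≤R 0≤Z)) ⟩
    A * (M * M) + A * R * 1ℚ * M                      ≡⟨ cong (λ t → A * (M * M) + A * R * t * M) iM≡1 ⟨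
    A * (M * M) + A * R * (i * M) * M
      ≡⟨ solve 4 (λ A M R i →
           A :* (M :* M) :+ A :* R :* (i :* M) :* M :=
           A :* ((con 1ℚ :+ R :* i) :* (M :* M))) refl A M R i ⟩
    A * (E * (M * M))                                 ≡⟨ cong (_* (E * (M * M))) PB≡A ⟨
    P * B * (E * (M * M))                             ≡⟨ *-assoc P B (E * (M * M)) ⟩
    P * (B * (E * (M * M)))                           ∎)
    where
    E = 1ℚ + R * i
    scale-pos = pos*pos⇒pos B {{positive 0<B}} (E * (M * M)) {{pos*pos⇒pos E {{positive 0<E}} (M * M)
            {{pos*pos⇒pos M {{positive 0<M}} M {{positive 0<M}}}}}}

-- Conditional probabilities as quotients of counts.

length-𝒢 : ∀ {n} (d : Vec ℕ n) {A : Pred (Graph n) 0ℓ} (A? : Decidable A) →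
           length (filter A? (𝒢 d)) ≡ ∑[ G ∈ graphs n ] 𝟙 (realises? d G ×-dec A? G)
length-𝒢 {n} d A? = begin
  length (filter A? (𝒢 d))                             ≡⟨ length-filter-∑ A? (𝒢 d) ⟩
  ∑[ G ∈ 𝒢 d ] 𝟙 (A? G)                                ≡⟨ ∑-filter (realises? d) (graphs n) _ ⟩
  ∑[ G ∈ graphs n ] (𝟙 (realises? d G) ℕ.* 𝟙 (A? G))   ≡⟨ ∑-cong (graphs n) (λ G → 𝟙-× (realises? d G) (A? G)) ⟨
  ∑[ G ∈ graphs n ] 𝟙 (realises? d G ×-dec A? G)       ∎
  where open ≡-Reasoning

-- Makes the count of the conditioning event positive, since an empty event would have probability
-- zero.
nonZero⇒0<ι : ∀ b N .{{_ : ℕ.NonZero N}} → NonZero (+ b / N) → 0ℚ < ι b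
nonZero⇒0<ι zero    N nz = contradiction refl (ℕ.≢-nonZero⁻¹ 0 {{subst NonZero (0/n≡0 N) nz}})
nonZero⇒0<ι (suc b) N nz = <-≤-trans (positive⁻¹ 1ℚ) (ι-mono-≤ {1} {suc b} (ℕ.s≤s ℕ.z≤n))

module _ {n} {d : Vec ℕ n} (graphical : Graphical d)
         {A B : Pred (Graph n) 0ℓ} (A? : Decidable A) (B? : Decidable B) where

  -- The common denominator `length (𝒢 d)` cancels; the multiplied form is the hypothesis
  -- `P * (A + C) ≡ A` of `Bounds`.
  condℙ-* : .{{_ : NonZero (ℙ graphical B?)}} →
    condℙ graphical A? B? * ι (length (filter B? (𝒢 d))) ≡ ι (length (filter (A? ∩? B?) (𝒢 d)))
  condℙ-* = begin
    (PAB ÷ PB) * ι b                ≡⟨ cong (λ x → (PAB ÷ PB) * x) (/-*-cancel b N) ⟨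
    (PAB ÷ PB) * (PB * ι N)         ≡⟨ *-assoc (PAB ÷ PB) PB (ι N) ⟨
    (PAB ÷ PB) * PB * ι N           ≡⟨ cong (_* ι N) (÷-*-cancel PAB PB) ⟩
    PAB * ι N                       ≡⟨ /-*-cancel (length (filter (A? ∩? B?) (𝒢 d))) N ⟩
    ι (length (filter (A? ∩? B?) (𝒢 d)))  ∎
    where
    open ≡-Reasoning
    PAB = ℙ graphical (A? ∩? B?)
    PB  = ℙ graphical B?
    b   = length (filter B? (𝒢 d))
    N   = length (𝒢 d)
    instance N≢0 = 𝒢-nonEmpty graphical

theorem1p1 : ∀ {n} (d : Vec ℕ n) (graphical : Graphical d) (H₁ H₂ : Graph n) →
    EdgeDisjoint H₁ H₂ →
    (H₁≼d : degrees H₁ ≼ d) →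
    (u v : Fin n) → u ≢ v → ¬ Adj H₁ u v → ¬ Adj H₂ u v →
    {{_ : NonZero (ℙ graphical (contains? H₁ ∩? avoids? H₂))}} →
    {{_ : NonZero (residualTotal d H₁)}} →
    ({{_ : Positive (fDenominator d H₁ H₂ u v)}} →
    condℙ graphical (Adj? u v) (contains? H₁ ∩? avoids? H₂)
    ≤ ratio d H₁ H₂ u v * f d H₁ H₂ u v)
    × (ratio d H₁ H₂ u v * g d H₁ H₂ u v H₁≼d
    ≤ condℙ graphical (Adj? u v) (contains? H₁ ∩? avoids? H₂))
theorem1p1 {n} d graphical H₁ H₂ _ H₁≼d u v u≢v ∉H₁ ∉H₂ {{PB≢0}} = upper , lower
  where
  open Switching d H₁ H₂
  open Counting d H₁ H₂

  a c e h : ℕ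
  a = #with u v
  c = #without u v
  e = edges H₂
  h = maximum (degrees H₂)

  B? = contains? H₁ ∩? avoids? H₂

  with≡ : length (filter (Adj? u v ∩? B?) (𝒢 d)) ≡ a
  with≡ = trans (length-𝒢 d (Adj? u v ∩? B?)) (∑-cong (graphs n) λ G →
    𝟙-cong (realises? d G ×-dec (Adj? u v ∩? B?) G) (admissible? G ×-dec Adj? u v G)
      (λ (G∈ , uv , res) → (G∈ , res) , uv) (λ ((G∈ , res) , uv) → G∈ , uv , res))

  -- The conditioning event together with the degree condition is admissibility by definition, and
  -- it splits by the presence of `uv`.
  all≡ : length (filter B? (𝒢 d)) ≡ a ℕ.+ c
  all≡ = trans (length-𝒢 d B?) (trans
    (∑-cong (graphs n) λ G → 𝟙-split (admissible? G) (Adj? u v G)) (∑-+ (graphs n) _ _))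

  M′ R P i X Y Z : ℚ
  M′ = residualTotal d H₁
  R = residualDegree d H₁ u * residualDegree d H₁ v
  P = condℙ graphical (Adj? u v) B?
  i = 1/ M′
  X = ι 3 * ι (J d) + ι Δ * (ι 8 + ι (deg H₂ u) + ι (deg H₂ v))
  Y = ι 2 * ι e * (ι Δ * ι Δ)
  Z = ι 2 * ι (J d) + ι 6 * ι Δ + ι 2 * ι h * ι Δ

  ιm≡ : ι m ≡ M′
  ιm≡ = ι-∸ (subst (ℕ._≤ Vec.sum d) (handshake H₁) (sum-mono-≼ (degrees H₁) d H₁≼d))

  ιr≡ : ∀ j → ι (r j) ≡ residualDegree d H₁ j
  ιr≡ j = ι-∸ (subst (ℕ._≤ lookup d j) (Vec.lookup∘tabulate (deg H₁) j) (H₁≼d j))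

  ιR≡ : ι (r u ℕ.* r v) ≡ R
  ιR≡ = trans (ι-* (r u) (r v)) (cong₂ _*_ (ιr≡ u) (ιr≡ v))

  -- Natural-number versions of `X` and `Z`, to be compared with `K` before casting.
  X′ Z′ : ℕ
  X′ = 3 ℕ.* J d ℕ.+ Δ ℕ.* (8 ℕ.+ deg H₂ u ℕ.+ deg H₂ v)
  Z′ = 2 ℕ.* J d ℕ.+ 6 ℕ.* Δ ℕ.+ 2 ℕ.* h ℕ.* Δ

  ιX≡ : ι X′ ≡ X
  ιX≡ = trans (ι-+ (3 ℕ.* J d) _) (cong₂ _+_ (ι-* 3 (J d))
    (trans (ι-* Δ _) (cong (λ x → ι Δ * x)
      (trans (ι-+ (8 ℕ.+ deg H₂ u) (deg H₂ v)) (cong (_+ ι (deg H₂ v)) (ι-+ 8 (deg H₂ u)))))))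

  ιZ≡ : ι Z′ ≡ Z
  ιZ≡ = trans (ι-+ (2 ℕ.* J d ℕ.+ 6 ℕ.* Δ) _) (cong₂ _+_
    (trans (ι-+ (2 ℕ.* J d) _) (cong₂ _+_ (ι-* 2 (J d)) (ι-* 6 Δ)))
    (trans (ι-* (2 ℕ.* h) Δ) (cong (_* ι Δ) (ι-* 2 h))))

  K≤X′ : K (deg H₂ u) (deg H₂ v) ℕ.≤ X′
  -- The surplus is 3J - 2J = J and 8Δ - 2Δ = 6Δ.
  K≤X′ = ℕ.≤-trans (ℕ.m≤m+n _ (J d ℕ.+ 6 ℕ.* Δ)) (ℕ.≤-reflexive (slack (J d) Δ (deg H₂ u) (deg H₂ v)))
    where
    slack : ∀ j e a b → (2 ℕ.* j ℕ.+ 2 ℕ.* e ℕ.+ (a ℕ.+ b) ℕ.* e) ℕ.+ (j ℕ.+ 6 ℕ.* e) ≡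
                        3 ℕ.* j ℕ.+ e ℕ.* (8 ℕ.+ a ℕ.+ b)
    slack = solve-∀

  K≤Z′ : K h h ℕ.≤ Z′
  -- Here the `J` terms agree and the surplus is 6Δ - 2Δ = 4Δ.
  K≤Z′ = ℕ.≤-trans (ℕ.m≤m+n _ (4 ℕ.* Δ)) (ℕ.≤-reflexive (slack (J d) Δ h))
    where
    slack : ∀ j e h → (2 ℕ.* j ℕ.+ 2 ℕ.* e ℕ.+ (h ℕ.+ h) ℕ.* e) ℕ.+ 4 ℕ.* e ≡
                      2 ℕ.* j ℕ.+ 6 ℕ.* e ℕ.+ 2 ℕ.* h ℕ.* e
    slack = solve-∀

  upperℕ : a ℕ.* m ℕ.≤ c ℕ.* (r u ℕ.* r v) ℕ.+ a ℕ.* X′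
  upperℕ = ℕ.≤-trans (#with-upper u v u≢v ∉H₁ ∉H₂)
    (ℕ.+-monoʳ-≤ (c ℕ.* (r u ℕ.* r v)) (ℕ.*-monoʳ-≤ a K≤X′))

  lowerℕ : c ℕ.* (r u ℕ.* r v) ℕ.* m ℕ.≤ a ℕ.* (m ℕ.* m) ℕ.+ c ℕ.* (r u ℕ.* r v) ℕ.* Z′
  lowerℕ = ℕ.≤-trans
    (#with-lower u v u≢v ∉H₁ ∉H₂ h λ j →
       subst (ℕ._≤ h) (Vec.lookup∘tabulate (deg H₂) j) (lookup≤maximum (degrees H₂) j))
    (ℕ.+-monoʳ-≤ (a ℕ.* (m ℕ.* m)) (ℕ.*-monoʳ-≤ (c ℕ.* (r u ℕ.* r v)) K≤Z′))

  ιcR≡ : ι (c ℕ.* (r u ℕ.* r v)) ≡ ι c * R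
  ιcR≡ = trans (ι-* c _) (cong (λ x → ι c * x) ιR≡)

  upperℚ : ι a * M′ ≤ ι c * R + ι a * X
  upperℚ = subst₂ _≤_ (trans (ι-* a m) (cong (λ x → ι a * x) ιm≡))
    (trans (ι-+ (c ℕ.* (r u ℕ.* r v)) _)
      (cong₂ _+_ ιcR≡ (trans (ι-* a X′) (cong (λ x → ι a * x) ιX≡))))
    (ι-mono-≤ upperℕ)

  lowerℚ : ι c * R * M′ ≤ ι a * (M′ * M′) + ι c * R * Z
  lowerℚ = subst₂ _≤_ (trans (ι-* (c ℕ.* (r u ℕ.* r v)) m) (cong₂ _*_ ιcR≡ ιm≡))
    (trans (ι-+ (a ℕ.* (m ℕ.* m)) _) (cong₂ _+_
      (trans (ι-* a (m ℕ.* m)) (cong (λ x → ι a * x) (trans (ι-* m m) (cong₂ _*_ ιm≡ ιm≡))))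
      (trans (ι-* (c ℕ.* (r u ℕ.* r v)) Z′) (cong₂ _*_ ιcR≡ ιZ≡))))
    (ι-mono-≤ lowerℕ)

  0≤Y : 0ℚ ≤ Y
  0≤Y = 0≤* (0≤* (0≤ι 2) (0≤ι e)) (0≤* (0≤ι Δ) (0≤ι Δ))

  0≤Z : 0ℚ ≤ Z
  0≤Z = subst (0ℚ ≤_) ιZ≡ (0≤ι Z′)

  0<M′ : 0ℚ < M′
  -- As the cast of the natural number `m`, `M′` is nonnegative; being nonzero by assumption, it is
  -- positive.
  0<M′ = positive⁻¹ M′ {{nonNeg∧nonZero⇒pos M′ {{nonNegative (subst (0ℚ ≤_) ιm≡ (0≤ι m))}}}}

  B≡ : ι (length (filter B? (𝒢 d))) ≡ ι a + ι c
  B≡ = trans (cong ι all≡) (ι-+ a c)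

  module Cleared = Bounds (ι a) (ι c) R M′ i P (*-inverseˡ M′) 0<M′ (0≤ι a)
    (subst (0ℚ ≤_) ιR≡ (0≤ι (r u ℕ.* r v)))
    (subst (0ℚ <_) B≡ (nonZero⇒0<ι (length (filter B? (𝒢 d))) (length (𝒢 d)) {{𝒢-nonEmpty graphical}} PB≢0))
    (trans (cong (λ x → P * x) (sym B≡)) (trans (condℙ-* graphical (Adj? u v) B?) (cong ι with≡)))

  upper : {{_ : Positive (fDenominator d H₁ H₂ u v)}} →
          P ≤ ratio d H₁ H₂ u v * f d H₁ H₂ u v
  -- Division by `M′` unfolds to multiplication by `i`, so `ratio` and `fDenominator` are by
  -- definition the expressions in `Bounds`.
  upper = Cleared.upper X Y (f d H₁ H₂ u v) 0≤Y (positive⁻¹ D) (*-inverseˡ D {{pos⇒nonZero D}}) upperℚ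
    where D = fDenominator d H₁ H₂ u v

  lower : ratio d H₁ H₂ u v * g d H₁ H₂ u v H₁≼d ≤ P
  lower = Cleared.lower Z ((1/ E) {{E≢0}}) 0≤Z (positive⁻¹ E {{E>0}}) (*-inverseˡ E {{E≢0}}) lowerℚ
    where
    E   = 1ℚ + ratio d H₁ H₂ u v
    E>0 = 1+ratio-positive d H₁ H₂ u v H₁≼d
    E≢0 = pos⇒nonZero E {{E>0}}
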